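{- Let $N\geq 2$ be even and $M_2=N/2$. For any non-zero choice of $(b_1,b_2)\in\mathbb{Z}_N^2$ with $\gcd(b_1,b_2,M_2)=1$, the linear code $C$ over $\mathbb{Z}_N$ generated by the rows of $$\begin{pmatrix} M_2 & 0 & M_2 & b_1 & -b_1 \\ {} M_2 & M_2 & 0 & b_2 & -b_2 \end{pmatrix}$$ is either a direct sum or it is isomorphic to the code generated by the rows of $$g=\begin{pmatrix} M_2 & M_2 & 0 & 0 & 0 \\ {} M_2 & 0 & M_2 & 1 & N-1 \end{pmatrix}.$$ The simplex $\Delta_C$ corresponding to the latter code has $h^*(\Delta_C,t)=\left(\tfrac{3N}{2}-1\right)t^2+\tfrac N2t+1$.
   Context: $\mathbb{Z}_N=\mathbb{Z}/N\mathbb{Z}$, with elements identified with the representatives $0,\dots,N-1$. A linear code of length $n$ over $\mathbb{Z}_N$ is a submodule of $\mathbb{Z}_N^n$. Two codes over the same $\mathbb{Z}_N$ and of the same length are isomorphic if they coincide after a permutation of coordinates. Direct sum: for codes $C_1$ over $\mathbb{Z}_{N_1}$ and $C_2$ over $\mathbb{Z}_{N_2}$, of lengths $\ge1$, with $L=\operatorname{lcm}(N_1,N_2)$, $C_1\oplus C_2$ is the code over $\mathbb{Z}_L$ consisting of all concatenations $\frac{L}{N_1}c_1\,|\,\frac{L}{N_2}c_2$, $c_i\in C_i$. A code is a direct sum if it is isomorphic to some $C_1\oplus C_2$. Simplex of a code: for a code $C\subseteq\mathbb{Z}_N^{d+1}$ all of whose words have coordinate sum $0\bmod N$, let $M=\pi^{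 -1}(C)\subseteq\mathbb{Z}^{d+1}$ with $\pi:\mathbb{Z}^{d+1}\to\mathbb{Z}_N^{d+1}$ the reduction map, and $\Delta_C=\operatorname{conv}(Ne_0,\dots,Ne_d)$, viewed as a $d$-dimensional lattice simplex with respect to the affine lattice $\operatorname{aff}(Ne_0,\dots,Ne_d)\cap M$. For a $d$-dimensional lattice polytope $\Delta$ with lattice $M'$, $h^*(\Delta,t)$ is defined by $1+\sum_{k\ge1}|k\Delta\cap M'|t^k=h^*(\Delta,t)/(1-t)^{d+1}$; for $\Delta_C$ one has $h^*(\Delta_C,t)=\sum_{c\in C}t^{\frac1N\sum_i c_i}$. -}

module Defs where

open import Data.Fin.Base using (Fin; toℕ; fromℕ<)
open import Data.Fin.Permutation using (Permutation′; _⟨$⟩ʳ_)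
open import Data.Fin.Properties using (_≟_)
open import Data.Integer.Base as ℤ using (ℤ; +_; 0ℤ; 1ℤ; -1ℤ)
open import Data.Integer.DivMod using (_%ℕ_; n%ℕd<d)
import Data.Integer.Properties as ℤ
open import Data.List.Base using (List; []; _∷_; length)
open import Data.List.Membership.Propositional using (_∈_)
open import Data.List.Relation.Unary.Unique.Propositional using (Unique)
open import Data.Nat.Base as ℕ using (ℕ; zero; suc; NonZero; _+_; _*_; _∸_; _/_)
open import Data.Nat.Divisibility using (_∣_)
open import Data.Nat.DivMod using (_mod_)
open import Data.Nat.GCD using (gcd)
open import Data.Nat.LCM using (lcm; gcd*lcm)
open import Data.Nat.Properties using (m*n≢0; m*n≢0⇒n≢0)
open import Data.Product.Base using (Σ-syntax; _×_)
open import Data.Rational.Base as ℚ using (ℚ; 0ℚ; 1ℚ)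
import Data.Rational.Properties as ℚ
open import Data.Vec.Base using (Vec; []; _∷_; _++_; map; zipWith; foldr′; replicate; lookup; tabulate; head; sum)
open import Function.Bundles using (_⇔_)
open import Level using (0ℓ)
open import Relation.Binary.PropositionalEquality.Core using (_≡_; sym; subst; subst₂)
open import Relation.Nullary.Decidable using (does)
open import Data.Bool.Base using (if_then_else_)
open import Relation.Unary using (Pred)

open import Algebra.Properties.CommutativeMonoid.Sum ℤ.+-0-commutativeMonoid using () renaming (sum to sumℤ)
open import Algebra.Properties.CommutativeMonoid.Sum ℚ.+-0-commutativeMonoid using () renaming (sum to sumℚ)

-- ℤ/N, elements identified with the representatives 0, …, N-1.
ℤ/ : ℕ → Set
ℤ/ N = Fin N

module _ {N : ℕ} .{{_ : NonZero N}} where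

  ⟦_⟧ : ℕ → ℤ/ N
  ⟦ a ⟧ = a mod N

  _+ₘ_ _*ₘ_ : ℤ/ N → ℤ/ N → ℤ/ N
  a +ₘ b = ⟦ toℕ a + toℕ b ⟧
  a *ₘ b = ⟦ toℕ a * toℕ b ⟧

  -ₘ_ : ℤ/ N → ℤ/ N
  -ₘ a = ⟦ N ∸ toℕ a ⟧

Word : ℕ → ℕ → Set
Word N n = Vec (ℤ/ N) n

WordSet : ℕ → ℕ → Set₁
WordSet N n = Pred (Word N n) 0ℓ

module _ {N n : ℕ} .{{_ : NonZero N}} where

  0ʷ : Word N n
  0ʷ = replicate n ⟦ 0 ⟧

  _+ʷ_ : Word N n → Word N n → Word N n
  _+ʷ_ = zipWith _+ₘ_

  _·ʷ_ : ℤ/ N → Word N n → Word N n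
  a ·ʷ c = map (a *ₘ_) c

  record IsLinearCode (C : WordSet N n) : Set where
    field
      0∈ : C 0ʷ
      +∈ : ∀ {c c′} → C c → C c′ → C (c +ʷ c′)
      ·∈ : ∀ a {c} → C c → C (a ·ʷ c)

  ⟨_⟩ : ∀ {k} → Vec (Word N n) k → WordSet N n
  ⟨_⟩ {k} rows c = Σ[ a ∈ Vec (ℤ/ N) k ] c ≡ foldr′ _+ʷ_ 0ʷ (zipWith _·ʷ_ a rows)

permute : ∀ {N n} → Permutation′ n → Word N n → Word N n
permute σ c = tabulate λ i → lookup c (σ ⟨$⟩ʳ i)

infix 4 _≅_

_≅_ : ∀ {N n} → WordSet N n → WordSet N n → Set
_≅_ {n = n} C C′ = Σ[ σ ∈ Permutation′ n ] (∀ c → C c ⇔ C′ (permute σ c))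

lcm≢0 : ∀ m n .{{_ : NonZero m}} .{{_ : NonZero n}} → NonZero (lcm m n)
lcm≢0 m n = m*n≢0⇒n≢0 (gcd m n) {{subst NonZero (sym (gcd*lcm m n)) (m*n≢0 m n)}}

-- c ↦ (L/N) c from ℤ/N to ℤ/L, meant for N ∣ L.
scale : ∀ N L .{{_ : NonZero N}} .{{_ : NonZero L}} → ℤ/ N → ℤ/ L
scale N L c = ⟦ (L / N) * toℕ c ⟧

_⊕_ : ∀ {N₁ N₂ n₁ n₂} .{{_ : NonZero N₁}} .{{_ : NonZero N₂}} →
      WordSet N₁ n₁ → WordSet N₂ n₂ → WordSet (lcm N₁ N₂) (n₁ + n₂)
_⊕_ {N₁} {N₂} {n₁} {n₂} C₁ C₂ c =
  Σ[ c₁ ∈ Word N₁ n₁ ] Σ[ c₂ ∈ Word N₂ n₂ ]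
    C₁ c₁ × C₂ c₂ × c ≡ map (scale N₁ L) c₁ ++ map (scale N₂ L) c₂
  where
  L = lcm N₁ N₂
  instance
    L≢0 : NonZero L
    L≢0 = lcm≢0 N₁ N₂

record IsDirectSum {N n : ℕ} (C : WordSet N n) : Set₁ where
  field
    {N₁ N₂ n₁ n₂}  : ℕ
    .{{N₁≢0}}      : NonZero N₁
    .{{N₂≢0}}      : NonZero N₂
    .{{n₁≢0}}      : NonZero n₁
    .{{n₂≢0}}      : NonZero n₂
    C₁             : WordSet N₁ n₁
    C₂             : WordSet N₂ n₂
    C₁-linear      : IsLinearCode C₁
    C₂-linear      : IsLinearCode C₂
    lcm≡N          : lcm N₁ N₂ ≡ N
    n₁+n₂≡n        : n₁ + n₂ ≡ n
    C≅C₁⊕C₂        : C ≅ subst₂ WordSet lcm≡N n₁+n₂≡n (C₁ ⊕ C₂)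

Point : ℕ → Set
Point n = Vec ℤ n

-- The simplex is the convex hull of the vertices; the affine lattice is the
-- intersection of `lattice` with the affine hull of the vertices.
record LatticeSimplex (d n : ℕ) : Set₁ where
  field
    vertices : Vec (Point n) (suc d)
    lattice  : Pred (Point n) 0ℓ

toℚ : ℤ → ℚ
toℚ z = z ℚ./ 1

-- The hulls are only tested on integral points and have integral generators,
-- so rational coefficients give the same sets as real ones.
record _∈aff_ {m n} (x : Point n) (vs : Vec (Point n) m) : Set where
  field
    coeff   : Fin m → ℚ
    sum≡1   : sumℚ coeff ≡ 1ℚ
    combine : ∀ j → sumℚ (λ i → coeff i ℚ.* toℚ (lookup (lookup vs i) j)) ≡ toℚ (lookup x j)

record _∈conv_ {m n} (x : Point n) (vs : Vec (Point n) m) : Set where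
  field
    affine      : x ∈aff vs
    nonNegative : ∀ i → 0ℚ ℚ.≤ _∈aff_.coeff affine i

dilate : ∀ {n} → Point n → ℕ → Point n → Point n
dilate o k v = zipWith (λ a b → a ℤ.+ + k ℤ.* (b ℤ.- a)) o v

module _ {d n} (Δ : LatticeSimplex d n) where
  open LatticeSimplex Δ

  AffineLattice : Pred (Point n) 0ℓ
  AffineLattice x = lattice x × x ∈aff vertices

  -- A multiple of a polytope in an affine lattice is taken with a lattice
  -- point as origin; here it is the first vertex.
  DilateLatticePoint : ℕ → Pred (Point n) 0ℓ
  DilateLatticePoint k x = AffineLattice x × x ∈conv map (dilate (head vertices) k) vertices

HasCardinality : ∀ {A : Set} → Pred A 0ℓ → ℕ → Set
HasCardinality {A} P m =
  Σ[ xs ∈ List A ] Unique xs × (∀ x → x ∈ xs ⇔ P x) × length xs ≡ m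

PowerSeries : Set
PowerSeries = ℕ → ℤ

-- Polynomials are given by their coefficients in order of increasing degree.
fromCoeffs : List ℤ → PowerSeries
fromCoeffs []       _       = 0ℤ
fromCoeffs (a ∷ as) zero    = a
fromCoeffs (a ∷ as) (suc k) = fromCoeffs as k

_⊛_ : PowerSeries → PowerSeries → PowerSeries
(f ⊛ g) k = sumℤ {suc k} λ i → f (toℕ i) ℤ.* g (k ∸ toℕ i)

_^⊛_ : PowerSeries → ℕ → PowerSeries
f ^⊛ zero  = fromCoeffs (1ℤ ∷ [])
f ^⊛ suc m = f ⊛ (f ^⊛ m)

1-t : PowerSeries
1-t = fromCoeffs (1ℤ ∷ -1ℤ ∷ [])

-- 1 + Σ_{k ≥ 1} L(k-1) t^k
ehrhartSeries : (ℕ → ℕ) → PowerSeries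
ehrhartSeries L zero    = 1ℤ
ehrhartSeries L (suc k) = + L k

-- `points k` is the number of lattice points in the (k+1)-st multiple of Δ.
record HasHStar {d n} (Δ : LatticeSimplex d n) (h : List ℤ) : Set where
  field
    points   : ℕ → ℕ
    counts   : ∀ k → HasCardinality (DilateLatticePoint Δ (suc k)) (points k)
    equation : ∀ k → ((1-t ^⊛ suc d) ⊛ ehrhartSeries points) k ≡ fromCoeffs h k

module _ {N n : ℕ} .{{_ : NonZero N}} where

  ZeroSum : WordSet N n → Set
  ZeroSum C = ∀ c → C c → N ∣ sum (map toℕ c)

  reduce : Point n → Word N n
  reduce = map λ z → fromℕ< (n%ℕd<d z N)

Ne : ∀ {n} → ℕ → Fin n → Point n
Ne N i = tabulate λ j → if does (i ≟ j) then + N else 0ℤ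

simplex : ∀ {N d} .{{_ : NonZero N}} (C : WordSet N (suc d)) → ZeroSum C → LatticeSimplex d (suc d)
simplex {N} C _ = record
  { vertices = tabulate (Ne N)
  ; lattice  = λ x → C (reduce x)
  }

module _ (N : ℕ) .{{_ : NonZero N}} where

  M₂ : ℤ/ N
  M₂ = ⟦ N / 2 ⟧

  rows-b : ℤ/ N → ℤ/ N → Vec (Word N 5) 2
  rows-b b₁ b₂ =
    (M₂ ∷ ⟦ 0 ⟧ ∷ M₂    ∷ b₁ ∷ (-ₘ b₁) ∷ []) ∷
    (M₂ ∷ M₂    ∷ ⟦ 0 ⟧ ∷ b₂ ∷ (-ₘ b₂) ∷ []) ∷ []

  rows-g : Vec (Word N 5) 2
  rows-g =
    (M₂ ∷ M₂    ∷ ⟦ 0 ⟧ ∷ ⟦ 0 ⟧ ∷ ⟦ 0 ⟧     ∷ []) ∷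
    (M₂ ∷ ⟦ 0 ⟧ ∷ M₂    ∷ ⟦ 1 ⟧ ∷ ⟦ N ∸ 1 ⟧ ∷ []) ∷ []

{-# OPTIONS --safe #-}

-- Write N = 2M. The codewords of C are (M(x+y), My, Mx, z, −z) with z = b₁x + b₂y.
--
-- If b₁ or b₂ is odd, then z has the parity of x, y or x + y, and otherwise z and the parities of
-- x and y are arbitrary: after exchanging two of the first three coordinates this is the code of g.
-- If both are even, then M is odd and the first three coordinates are independent of the last two,
-- so that C is a direct sum.
--
-- For the h*-polynomial, a lattice point of the k-th multiple of Δ_C is, up to a translation, a point
-- c + N q with c ∈ C (represented in [0, N)ⁿ) and q ∈ ℕⁿ with coordinate sum k − |c|/N. Hence the
-- Ehrhart series is Σ_c t^(|c|/N) / (1-t)ⁿ. The words (M(a+z), Ma, Mz, z, −z), a ∈ {0,1}, 0 ≤ z < N,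
-- have weight |c|/N = 2 except for weight 0 at a = z = 0, and weight 1 at a = 1, z = 0 and at
-- a = 0, z > 0 even.
module Submission where

open import Defs
open import Algebra.Bundles using (Ring)
open import Data.Empty using (⊥)
open import Data.Bool.Base using (if_then_else_)
open import Data.Fin.Base using (Fin; zero; suc; toℕ; fromℕ<)
open import Data.Fin.Patterns using (0F; 1F; 2F)
import Data.Fin.Permutation as Perm
open import Data.Fin.Properties using (_≟_; toℕ-injective; toℕ-fromℕ<; toℕ<n)
open import Data.Integer.Base using (+_; _-_)
open import Data.Integer.Base as ℤ using (ℤ; 0ℤ; 1ℤ; -1ℤ)
open import Data.Integer.DivMod using (_%ℕ_; _/ℕ_; n%ℕd<d; a≡a%ℕn+[a/ℕn]*n)
import Data.Integer.Properties as ℤ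
import Data.Integer.Tactic.RingSolver as ℤ
open import Data.List.Base using ([]; _∷_)
open import Data.List.Base as List using (List; length; allFin; applyUpTo)
open import Data.List.Membership.Propositional using (_∈_)
open import Data.List.Membership.Propositional.Properties using (∈-map⁺; ∈-map⁻; ∈-++⁺ˡ; ∈-++⁺ʳ; ∈-++⁻; ∈-allFin)
open import Data.List.Properties using (length-map; length-++; map-tabulate; map-++; map-∘)
open import Data.List.Relation.Unary.All as All using ([])
open import Data.List.Relation.Unary.AllPairs using ([]; _∷_)
open import Data.List.Relation.Unary.Any using (here; there)
open import Data.List.Relation.Unary.Unique.Propositional using (Unique)
import Data.List.Relation.Unary.Unique.Propositional.Properties as Unique
open import Data.Nat.Base
import Data.Nat.Coprimality as Coprime
open import Data.Nat.Divisibility using (_∣_; divides; ∣-antisym; ∣-refl; ∣m+n∣m⇒∣n; n∣m*n; >⇒∤)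
open import Data.Nat.DivMod
open import Data.Nat.GCD using (gcd; gcd-GCD; gcd-comm; gcd-greatest; module Bézout)
open import Data.Nat.LCM using (lcm; lcm-least; m∣lcm[m,n])
open import Data.Nat.Properties hiding (_≟_)
open import Data.Nat.Tactic.RingSolver using (solve-∀)
open import Data.Product.Base using (_×_; _,_; ∃₂; ∃-syntax; Σ-syntax; proj₁; proj₂)
open import Data.Rational.Base as ℚ using (ℚ; mkℚ; 0ℚ; 1ℚ; *≤*)
import Data.Rational.Properties as ℚ
open import Data.Sum.Base using (_⊎_; inj₁; inj₂)
open import Data.Vec.Base using (Vec; []; _∷_; _++_; map; zipWith; sum; lookup; tabulate)
open import Data.Vec.Properties using (∷-injective; ∷-injectiveˡ; ∷-injectiveʳ; lookup-map; lookup-zipWith; lookup∘tabulate; tabulate∘lookup; tabulate-cong)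
open import Function.Base using (_∘_; id; it)
open import Function.Bundles using (_⇔_; mk⇔; Equivalence)
open import Relation.Binary.Bundles using (Setoid)
open import Relation.Binary.PropositionalEquality
import Relation.Binary.Reasoning.Setoid as SetoidReasoning
open import Relation.Nullary.Decidable using (does)
open import Relation.Nullary.Negation using (¬_; contradiction)

open import Algebra.Properties.AbelianGroup ℤ.+-0-abelianGroup using () renaming (∙-cancelʳ to ℤ-cancelʳ)
open import Algebra.Properties.Semiring.Sum ℤ.+-*-semiring using () renaming (sum to sumℤ; sum-cong-≋ to sumℤ-cong; ∑-distrib-+ to sumℤ-distrib-+; sum-replicate-zero to sumℤ-zero; *-distribˡ-sum to *-distribˡ-sumℤ)
open import Algebra.Properties.Semiring.Sum (Ring.semiring ℚ.+-*-ring) using () renaming (sum to sumℚ; sum-cong-≋ to sumℚ-cong; ∑-distrib-+ to sumℚ-distrib-+; sum-replicate-zero to sumℚ-zero; *-distribʳ-sum to *-distribʳ-sumℚ)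

-- Congruences

-- Modulo N = 2M the product M a depends only on the parity of a, so the first three coordinates are
-- the three nonzero linear forms in the parities of x and y. If b₁ or b₂ is odd, z modulo 2 is one
-- of these forms. In the code of g it stands in third place, and the exchange of coordinates moves
-- it there; since the three forms add up to zero, the other two are then a and a + z. The gcd
-- hypothesis speaks of M, while z lives modulo 2M: an odd coefficient is what extends coprimality
-- from M to 2M. With both coefficients even, M is odd and ℤ/N splits as ℤ/2 × ℤ/M; the first three
-- coordinates live in the first factor and the last two in the second. On the Ehrhart side nothing
-- is ever divided by a power of 1 - t: the factors 1 - t are multiplied in one at a time, each
-- undoing one step of the recursion that enumerates the vectors q. Residues are handled as natural
-- numbers up to congruence, with -1 represented by `pred N`, which turns identities between
-- codewords into semiring identities.

infix 4 _≈_[mod_]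

-- A multiple on each side replaces an integer quotient: closure under sums and products is then
-- additive, with no comparison of `a` with `b` and no truncated subtraction.
record _≈_[mod_] (a b m : ℕ) : Set where
  constructor multiples
  field
    k l      : ℕ
    equation : a + k * m ≡ b + l * m

module _ {m : ℕ} where

  ≈-reflexive : ∀ {a b} → a ≡ b → a ≈ b [mod m ]
  ≈-reflexive refl = multiples 0 0 refl

  ≈-refl : ∀ {a} → a ≈ a [mod m ]
  ≈-refl = ≈-reflexive refl

  ≈-sym : ∀ {a b} → a ≈ b [mod m ] → b ≈ a [mod m ]
  ≈-sym (multiples k l e) = multiples l k (sym e)

  ≈-trans : ∀ {a b c} → a ≈ b [mod m ] → b ≈ c [mod m ] → a ≈ c [mod m ]
  ≈-trans {a} {b} {c} (multiples k l e) (multiples k′ l′ e′) = multiples (k + k′) (l + l′) (begin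
    a + (k + k′) * m      ≡⟨ split a k k′ ⟩
    (a + k * m) + k′ * m  ≡⟨ cong (_+ k′ * m) e ⟩
    (b + l * m) + k′ * m  ≡⟨ swap b l k′ ⟩
    (b + k′ * m) + l * m  ≡⟨ cong (_+ l * m) e′ ⟩
    (c + l′ * m) + l * m  ≡⟨ sym (trans (split c l l′) (swap c l l′)) ⟩
    c + (l + l′) * m      ∎)
    where
    open ≡-Reasoning
    split : ∀ a k k′ → a + (k + k′) * m ≡ (a + k * m) + k′ * m
    split a k k′ = trans (cong (_+_ a) (*-distribʳ-+ m k k′)) (sym (+-assoc a (k * m) (k′ * m)))
    swap : ∀ b k k′ → (b + k * m) + k′ * m ≡ (b + k′ * m) + k * m
    swap b k k′ = trans (+-assoc b _ _) (trans (cong (_+_ b) (+-comm (k * m) _)) (sym (+-assoc b _ _)))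

  +-cong-≈ : ∀ {a b c d} → a ≈ b [mod m ] → c ≈ d [mod m ] → a + c ≈ b + d [mod m ]
  +-cong-≈ {a} {b} {c} {d} (multiples k l e) (multiples k′ l′ e′) = multiples (k + k′) (l + l′) (begin
    a + c + (k + k′) * m        ≡⟨ interchange a c k k′ m ⟩
    (a + k * m) + (c + k′ * m)  ≡⟨ cong₂ _+_ e e′ ⟩
    (b + l * m) + (d + l′ * m)  ≡⟨ interchange b d l l′ m ⟨
    b + d + (l + l′) * m        ∎)
    where
    open ≡-Reasoning
    interchange : ∀ a c k k′ m → a + c + (k + k′) * m ≡ (a + k * m) + (c + k′ * m)
    interchange = solve-∀

  *-congˡ-≈ : ∀ c {a b} → a ≈ b [mod m ] → c * a ≈ c * b [mod m ]
  *-congˡ-≈ c {a} {b} (multiples k l e) = multiples (c * k) (c * l) (begin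
    c * a + c * k * m  ≡⟨ distribute c a k m ⟩
    c * (a + k * m)    ≡⟨ cong (c *_) e ⟩
    c * (b + l * m)    ≡⟨ distribute c b l m ⟨
    c * b + c * l * m  ∎)
    where
    open ≡-Reasoning
    distribute : ∀ c a k m → c * a + c * k * m ≡ c * (a + k * m)
    distribute = solve-∀

  *-cong-≈ : ∀ {a b c d} → a ≈ b [mod m ] → c ≈ d [mod m ] → a * c ≈ b * d [mod m ]
  *-cong-≈ {a} {b} {c} {d} p q = ≈-trans (*-congˡ-≈ a q)
    (≈-trans (≈-reflexive (*-comm a d)) (≈-trans (*-congˡ-≈ d p) (≈-reflexive (*-comm d b))))

  +-multiple-≈ : ∀ a k → a + k * m ≈ a [mod m ]
  +-multiple-≈ a k = multiples 0 k (+-identityʳ _)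

  -- The modulus grows with the factor. For `c` = M and `m` = 2 this turns a parity into a residue
  -- modulo N, which is how all entries that are multiples of M are compared.
  *-scale-≈ : ∀ c {a b} → a ≈ b [mod m ] → c * a ≈ c * b [mod c * m ]
  *-scale-≈ c {a} {b} (multiples k l e) = multiples k l (begin
    c * a + k * (c * m)  ≡⟨ distribute c a k m ⟩
    c * (a + k * m)      ≡⟨ cong (c *_) e ⟩
    c * (b + l * m)      ≡⟨ distribute c b l m ⟨
    c * b + l * (c * m)  ∎)
    where
    open ≡-Reasoning
    distribute : ∀ c a k m → c * a + k * (c * m) ≡ c * (a + k * m)
    distribute = solve-∀

≈-modulus : ∀ {a b m n} → m ≡ n → a ≈ b [mod m ] → a ≈ b [mod n ]
≈-modulus refl a≈b = a≈b

≈-setoid : ℕ → Setoid _ _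
≈-setoid m = record
  { Carrier       = ℕ
  ; _≈_           = λ a b → a ≈ b [mod m ]
  ; isEquivalence = record { refl = ≈-refl ; sym = ≈-sym ; trans = ≈-trans }
  }

module ≈-Reasoning m = SetoidReasoning (≈-setoid m)

%-≈ : ∀ a m .{{_ : NonZero m}} → a % m ≈ a [mod m ]
%-≈ a m = multiples (a / m) 0 (trans (sym (m≡m%n+[m/n]*n a m)) (sym (+-identityʳ a)))

≈⇒%≡ : ∀ {a b m} .{{_ : NonZero m}} → a ≈ b [mod m ] → a % m ≡ b % m
≈⇒%≡ {a} {b} {m} (multiples k l e) =
  trans (sym ([m+kn]%n≡m%n a k m)) (trans (cong (_% m) e) ([m+kn]%n≡m%n b l m))

-- `pred m` is -1 modulo `m`, a negation that stays inside ℕ and commutes with linear combinations.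
pred-*-inverse : ∀ m .{{_ : NonZero m}} a → pred m * a + a ≈ 0 [mod m ]
pred-*-inverse (suc n) a = multiples 0 a (absorb n a)
  where
  absorb : ∀ n a → n * a + a + 0 ≡ a * suc n
  absorb = solve-∀

-- Links the representative `m ∸ a` of a negative, as in `-ₘ_`, to multiplication by -1; `a ≤ m`
-- keeps the subtraction from truncating.
∸-≈-pred-* : ∀ {a m} .{{_ : NonZero m}} → a ≤ m → m ∸ a ≈ pred m * a [mod m ]
∸-≈-pred-* {a} {suc n} a≤m = multiples a 1 (begin
  suc n ∸ a + a * suc n        ≡⟨ cong (_+_ (suc n ∸ a)) (trans (*-suc a n) (cong (_+_ a) (*-comm a n))) ⟩
  suc n ∸ a + (a + n * a)      ≡⟨ +-assoc (suc n ∸ a) a (n * a) ⟨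
  suc n ∸ a + a + n * a        ≡⟨ cong (_+ n * a) (m∸n+n≡m a≤m) ⟩
  suc n + n * a                ≡⟨ trans (+-comm (suc n) (n * a)) (cong (_+_ (n * a)) (sym (*-identityˡ (suc n)))) ⟩
  n * a + 1 * suc n            ∎)
  where open ≡-Reasoning

-- Multiplication by pred K replaces the negative coefficient in Bézout's identity.
bézout-≈ : ∀ K .{{_ : NonZero K}} m n → ∃₂ λ u v → u * m + v * n ≈ gcd m n [mod K ]
bézout-≈ (suc p) m n with Bézout.identity (gcd-GCD m n)
... | Bézout.+- x y e = x , p * y , multiples 0 (y * n) (begin
  x * m + p * y * n + 0         ≡⟨ cong (λ □ → □ + p * y * n + 0) e ⟨
  gcd m n + y * n + p * y * n + 0  ≡⟨ rearrange (gcd m n) y n p ⟩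
  gcd m n + y * n * suc p       ∎)
  where
  open ≡-Reasoning
  rearrange : ∀ g y n p → g + y * n + p * y * n + 0 ≡ g + y * n * suc p
  rearrange = solve-∀
... | Bézout.-+ x y e = p * x , y , multiples 0 (x * m) (begin
  p * x * m + y * n + 0         ≡⟨ cong (λ □ → p * x * m + □ + 0) e ⟨
  p * x * m + (gcd m n + x * m) + 0  ≡⟨ rearrange (gcd m n) x m p ⟩
  gcd m n + x * m * suc p       ∎)
  where
  open ≡-Reasoning
  rearrange : ∀ g x m p → p * x * m + (g + x * m) + 0 ≡ g + x * m * suc p
  rearrange = solve-∀

module _ {M b₁ b₂ : ℕ} .{{_ : NonZero M}} (coprime : gcd (gcd b₁ b₂) M ≡ 1) (b₁-odd : b₁ ≈ 1 [mod 2 ]) where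

  private instance
    M*2≢0 : NonZero (M * 2)
    M*2≢0 = m*n≢0 M 2

  -- As b₁ is odd, M ≡ M b₁ modulo 2M, which turns the M-term of the Bézout identity into a multiple of b₁.
  unit-combination : ∃₂ λ u v → u * b₁ + v * b₂ ≈ 1 [mod M * 2 ]
  unit-combination =
    let u , v , g≈ = bézout-≈ (M * 2) b₁ b₂
        s , t , 1≈ = bézout-≈ (M * 2) (gcd b₁ b₂) M
        open ≈-Reasoning (M * 2)
    in s * u + t * M , s * v , (begin
      (s * u + t * M) * b₁ + s * v * b₂         ≡⟨ collect s u t M b₁ v b₂ ⟩
      s * (u * b₁ + v * b₂) + t * (M * b₁)      ≈⟨ +-cong-≈ (*-congˡ-≈ s g≈) (*-congˡ-≈ t (*-scale-≈ M b₁-odd)) ⟩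
      s * gcd b₁ b₂ + t * (M * 1)               ≡⟨ cong (λ □ → s * gcd b₁ b₂ + t * □) (*-identityʳ M) ⟩
      s * gcd b₁ b₂ + t * M                     ≈⟨ 1≈ ⟩
      gcd (gcd b₁ b₂) M                         ≡⟨ coprime ⟩
      1                                         ∎)
    where
    collect : ∀ s u t M b₁ v b₂ → (s * u + t * M) * b₁ + s * v * b₂ ≡ s * (u * b₁ + v * b₂) + t * (M * b₁)
    collect = solve-∀

  -- A solution z (u, v) of the congruence is corrected by a multiple of (−b₂, b₁) to fix the parity of y.
  solvable : ∀ a z → ∃₂ λ x y → x * b₁ + y * b₂ ≈ z [mod M * 2 ] × y ≈ a [mod 2 ]
  solvable a z =
    let u , v , unit = unit-combination
        p = pred (M * 2)
        k = a + z * v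
    in z * u + k * (p * b₂) , z * v + k * b₁ ,
      (let open ≈-Reasoning (M * 2) in begin
        (z * u + k * (p * b₂)) * b₁ + (z * v + k * b₁) * b₂  ≡⟨ rearrange z u k p b₂ b₁ v ⟩
        z * (u * b₁ + v * b₂) + k * b₁ * (p * b₂ + b₂)      ≈⟨ +-cong-≈ (*-congˡ-≈ z unit) (*-congˡ-≈ (k * b₁) (pred-*-inverse (M * 2) b₂)) ⟩
        z * 1 + k * b₁ * 0                                  ≡⟨ simplify z (k * b₁) ⟩
        z                                                   ∎) ,
      (let open ≈-Reasoning 2 in begin
        z * v + (a + z * v) * b₁  ≈⟨ +-cong-≈ ≈-refl (*-congˡ-≈ k b₁-odd) ⟩
        z * v + (a + z * v) * 1   ≡⟨ double a (z * v) ⟩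
        a + (z * v) * 2           ≈⟨ +-multiple-≈ a (z * v) ⟩
        a                         ∎)
    where
    rearrange : ∀ z u k p b₂ b₁ v → (z * u + k * (p * b₂)) * b₁ + (z * v + k * b₁) * b₂ ≡ z * (u * b₁ + v * b₂) + k * b₁ * (p * b₂ + b₂)
    rearrange = solve-∀
    simplify : ∀ z c → z * 1 + c * 0 ≡ z
    simplify = solve-∀
    double : ∀ a c → c + (a + c) * 1 ≡ a + c * 2
    double = solve-∀

module _ {N : ℕ} .{{_ : NonZero N}} where

  toℕ-⟦⟧ : ∀ a → toℕ (⟦_⟧ {N} a) ≡ a % N
  toℕ-⟦⟧ a = toℕ-fromℕ< (m%n<n a N)

  ≈⇒⟦⟧≡ : ∀ {a b} → a ≈ b [mod N ] → ⟦_⟧ {N} a ≡ ⟦ b ⟧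
  ≈⇒⟦⟧≡ {a} {b} a≈b = toℕ-injective (trans (toℕ-⟦⟧ a) (trans (≈⇒%≡ a≈b) (sym (toℕ-⟦⟧ b))))

  toℕ-⟦⟧-≈ : ∀ a → toℕ (⟦_⟧ {N} a) ≈ a [mod N ]
  toℕ-⟦⟧-≈ a = ≈-trans (≈-reflexive (toℕ-⟦⟧ a)) (%-≈ a N)

  ⟦toℕ⟧ : ∀ (a : ℤ/ N) → ⟦ toℕ a ⟧ ≡ a
  ⟦toℕ⟧ a = toℕ-injective (trans (toℕ-⟦⟧ (toℕ a)) (m<n⇒m%n≡m (toℕ<n a)))

  +ₘ-⟦⟧ : ∀ a b → ⟦_⟧ {N} a +ₘ ⟦ b ⟧ ≡ ⟦ a + b ⟧
  +ₘ-⟦⟧ a b = ≈⇒⟦⟧≡ (+-cong-≈ (toℕ-⟦⟧-≈ a) (toℕ-⟦⟧-≈ b))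

  *ₘ-⟦⟧ : ∀ a b → ⟦_⟧ {N} a *ₘ ⟦ b ⟧ ≡ ⟦ a * b ⟧
  *ₘ-⟦⟧ a b = ≈⇒⟦⟧≡ (*-cong-≈ (toℕ-⟦⟧-≈ a) (toℕ-⟦⟧-≈ b))

  -ₘ-⟦⟧ : ∀ (b : ℤ/ N) → (-ₘ b) ≡ ⟦ pred N * toℕ b ⟧
  -ₘ-⟦⟧ b = ≈⇒⟦⟧≡ (∸-≈-pred-* (<⇒≤ (toℕ<n b)))

-- Codes

linearCombination : ∀ {n} → ℕ → ℕ → Vec ℕ n → Vec ℕ n → Vec ℕ n
linearCombination x y = zipWith (λ a b → x * a + y * b)

module _ {N : ℕ} .{{_ : NonZero N}} where

  -- The code generated by two rows, but with natural rows and coefficients and a single reduction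
  -- at the end.
  Span : ∀ {n} → Vec ℕ n → Vec ℕ n → WordSet N n
  Span r s c = ∃₂ λ x y → c ≡ map ⟦_⟧ (linearCombination x y r s)

  linearCombination-⟦⟧ : ∀ {n} x y (r s : Vec ℕ n) →
               (⟦_⟧ {N} x ·ʷ map ⟦_⟧ r) +ʷ ((⟦ y ⟧ ·ʷ map ⟦_⟧ s) +ʷ 0ʷ) ≡ map ⟦_⟧ (linearCombination x y r s)
  linearCombination-⟦⟧ x y []      []      = refl
  linearCombination-⟦⟧ x y (a ∷ r) (b ∷ s) = cong₂ _∷_ entry (linearCombination-⟦⟧ x y r s)
    where
    entry : (⟦ x ⟧ *ₘ ⟦ a ⟧) +ₘ ((⟦ y ⟧ *ₘ ⟦ b ⟧) +ₘ ⟦ 0 ⟧) ≡ ⟦ x * a + y * b ⟧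
    entry rewrite *ₘ-⟦⟧ {N} x a | *ₘ-⟦⟧ {N} y b | +ₘ-⟦⟧ {N} (y * b) 0 | +ₘ-⟦⟧ {N} (x * a) (y * b + 0)
                | +-identityʳ (y * b) = refl

  ⟨⟩⇔Span : ∀ {n} (r s : Vec ℕ n) c → ⟨ map ⟦_⟧ r ∷ map ⟦_⟧ s ∷ [] ⟩ c ⇔ Span r s c
  ⟨⟩⇔Span r s c = mk⇔
    (λ { (x ∷ y ∷ [] , e) → toℕ x , toℕ y ,
         trans e (trans (cong₂ (λ x y → (x ·ʷ map ⟦_⟧ r) +ʷ ((y ·ʷ map ⟦_⟧ s) +ʷ 0ʷ)) (sym (⟦toℕ⟧ x)) (sym (⟦toℕ⟧ y)))
                        (linearCombination-⟦⟧ (toℕ x) (toℕ y) r s)) })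
    (λ { (x , y , e) → ⟦ x ⟧ ∷ ⟦ y ⟧ ∷ [] , trans e (sym (linearCombination-⟦⟧ x y r s)) })

  Span-linear : ∀ {n} (r s : Vec ℕ n) → IsLinearCode (Span r s)
  Span-linear r s = record
    { 0∈ = 0 , 0 , zero-word r s
    ; +∈ = λ { (x , y , refl) (x′ , y′ , refl) → x + x′ , y + y′ , add x y x′ y′ r s }
    ; ·∈ = λ { a (x , y , refl) → toℕ a * x , toℕ a * y , multiply a x y r s }
    }
    where
    zero-word : ∀ {n} (r s : Vec ℕ n) → 0ʷ ≡ map (⟦_⟧ {N}) (linearCombination 0 0 r s)
    zero-word []      []      = refl
    zero-word (_ ∷ r) (_ ∷ s) = cong (⟦ 0 ⟧ ∷_) (zero-word r s)

    add : ∀ {n} x y x′ y′ (r s : Vec ℕ n) →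
          map (⟦_⟧ {N}) (linearCombination x y r s) +ʷ map ⟦_⟧ (linearCombination x′ y′ r s) ≡ map ⟦_⟧ (linearCombination (x + x′) (y + y′) r s)
    add x y x′ y′ []      []      = refl
    add x y x′ y′ (a ∷ r) (b ∷ s) = cong₂ _∷_
      (trans (+ₘ-⟦⟧ (x * a + y * b) _) (cong ⟦_⟧ (collect x y x′ y′ a b)))
      (add x y x′ y′ r s)
      where
      collect : ∀ x y x′ y′ a b → x * a + y * b + (x′ * a + y′ * b) ≡ (x + x′) * a + (y + y′) * b
      collect = solve-∀

    multiply : ∀ {n} (c : ℤ/ N) x y (r s : Vec ℕ n) →
               c ·ʷ map ⟦_⟧ (linearCombination x y r s) ≡ map ⟦_⟧ (linearCombination (toℕ c * x) (toℕ c * y) r s)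
    multiply c x y []      []      = refl
    multiply c x y (a ∷ r) (b ∷ s) = cong₂ _∷_
      (trans (cong (_*ₘ ⟦ x * a + y * b ⟧) (sym (⟦toℕ⟧ c)))
        (trans (*ₘ-⟦⟧ (toℕ c) _) (cong ⟦_⟧ (distribute (toℕ c) x a y b))))
      (multiply c x y r s)
      where
      distribute : ∀ c x a y b → c * (x * a + y * b) ≡ c * x * a + c * y * b
      distribute = solve-∀

module _ (N : ℕ) .{{_ : NonZero N}} where

  private
    M : ℕ
    M = N / 2

  cong₅ : ∀ {a a′ b b′ c c′ d d′ e e′} → a ≡ a′ → b ≡ b′ → c ≡ c′ → d ≡ d′ → e ≡ e′ →
          _≡_ {A = Word N 5} (⟦ a ⟧ ∷ ⟦ b ⟧ ∷ ⟦ c ⟧ ∷ ⟦ d ⟧ ∷ ⟦ e ⟧ ∷ []) (⟦ a′ ⟧ ∷ ⟦ b′ ⟧ ∷ ⟦ c′ ⟧ ∷ ⟦ d′ ⟧ ∷ ⟦ e′ ⟧ ∷ [])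
  cong₅ refl refl refl refl refl = refl

  word : ℕ → ℕ → ℕ → ℕ → Word N 5
  word p q r z = ⟦ p ⟧ ∷ ⟦ q ⟧ ∷ ⟦ r ⟧ ∷ ⟦ z ⟧ ∷ ⟦ pred N * z ⟧ ∷ []

  word-cong : ∀ {p p′ q q′ r r′ z z′} → p ≈ p′ [mod N ] → q ≈ q′ [mod N ] → r ≈ r′ [mod N ] → z ≈ z′ [mod N ] →
              word p q r z ≡ word p′ q′ r′ z′
  word-cong p≈ q≈ r≈ z≈ =
    cong₂ _∷_ (≈⇒⟦⟧≡ p≈) (cong₂ _∷_ (≈⇒⟦⟧≡ q≈) (cong₂ _∷_ (≈⇒⟦⟧≡ r≈)
      (cong₂ _∷_ (≈⇒⟦⟧≡ z≈) (cong₂ _∷_ (≈⇒⟦⟧≡ (*-congˡ-≈ (pred N) z≈)) refl))))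

  word-b : ℕ → ℕ → ℕ → ℕ → Word N 5
  word-b b₁ b₂ x y = word (M * (x + y)) (M * y) (M * x) (x * b₁ + y * b₂)

  word-g : ℕ → ℕ → Word N 5
  word-g a z = word (M * (a + z)) (M * a) (M * z) z

  -- Keeps the generating rows visible: the direct sum decomposition cuts them after the third
  -- coordinate.
  rows-b⇔Span : ∀ b₁ b₂ c → ⟨ rows-b N b₁ b₂ ⟩ c ⇔
                Span (M ∷ 0 ∷ M ∷ toℕ b₁ ∷ pred N * toℕ b₁ ∷ []) (M ∷ M ∷ 0 ∷ toℕ b₂ ∷ pred N * toℕ b₂ ∷ []) c
  rows-b⇔Span b₁ b₂ c = subst (λ rows → ⟨ rows ⟩ c ⇔ Span r s c) (sym rows≡) (⟨⟩⇔Span r s c)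
    where
    r s : Vec ℕ 5
    r = M ∷ 0 ∷ M ∷ toℕ b₁ ∷ pred N * toℕ b₁ ∷ []
    s = M ∷ M ∷ 0 ∷ toℕ b₂ ∷ pred N * toℕ b₂ ∷ []

    rows≡ : rows-b N b₁ b₂ ≡ map ⟦_⟧ r ∷ map ⟦_⟧ s ∷ []
    rows≡ = cong₂ (λ r s → r ∷ s ∷ [])
      (cong₂ (λ b b′ → M₂ N ∷ ⟦ 0 ⟧ ∷ M₂ N ∷ b ∷ b′ ∷ []) (sym (⟦toℕ⟧ b₁)) (-ₘ-⟦⟧ b₁))
      (cong₂ (λ b b′ → M₂ N ∷ M₂ N ∷ ⟦ 0 ⟧ ∷ b ∷ b′ ∷ []) (sym (⟦toℕ⟧ b₂)) (-ₘ-⟦⟧ b₂))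

  rows-b⇔ : ∀ b₁ b₂ c → ⟨ rows-b N b₁ b₂ ⟩ c ⇔ (∃₂ λ x y → c ≡ word-b (toℕ b₁) (toℕ b₂) x y)
  rows-b⇔ b₁ b₂ c = mk⇔
    (λ c∈ → let x , y , e = Equivalence.to (rows-b⇔Span b₁ b₂ c) c∈ in x , y , trans e (linearCombination≡ x y))
    (λ { (x , y , e) → Equivalence.from (rows-b⇔Span b₁ b₂ c) (x , y , trans e (sym (linearCombination≡ x y))) })
    where
    e₀ : ∀ M x y → x * M + y * M ≡ M * (x + y)
    e₀ = solve-∀
    e₁ : ∀ M x y → x * 0 + y * M ≡ M * y
    e₁ = solve-∀
    e₂ : ∀ M x y → x * M + y * 0 ≡ M * x
    e₂ = solve-∀
    e₄ : ∀ p b₁ b₂ x y → x * (p * b₁) + y * (p * b₂) ≡ p * (x * b₁ + y * b₂)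
    e₄ = solve-∀

    linearCombination≡ : ∀ x y → _ ≡ word-b (toℕ b₁) (toℕ b₂) x y
    linearCombination≡ x y = cong₅ (e₀ M x y) (e₁ M x y) (e₂ M x y) refl (e₄ (pred N) (toℕ b₁) (toℕ b₂) x y)

  rows-g⇔ : ∀ c → ⟨ rows-g N ⟩ c ⇔ (∃₂ λ a z → c ≡ word-g a z)
  rows-g⇔ c = mk⇔
    (λ c∈ → let a , z , e = Equivalence.to (⟨⟩⇔Span r s c) c∈ in a , z , trans e (linearCombination≡ a z))
    (λ { (a , z , e) → Equivalence.from (⟨⟩⇔Span r s c) (a , z , trans e (sym (linearCombination≡ a z))) })
    where
    r s : Vec ℕ 5
    r = M ∷ M ∷ 0 ∷ 0 ∷ 0 ∷ []
    s = M ∷ 0 ∷ M ∷ 1 ∷ pred N ∷ []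

    e₀ : ∀ M a z → a * M + z * M ≡ M * (a + z)
    e₀ = solve-∀
    e₁ : ∀ M a z → a * M + z * 0 ≡ M * a
    e₁ = solve-∀
    e₂ : ∀ M a z → a * 0 + z * M ≡ M * z
    e₂ = solve-∀
    e₃ : ∀ a z → a * 0 + z * 1 ≡ z
    e₃ = solve-∀
    e₄ : ∀ p a z → a * 0 + z * p ≡ p * z
    e₄ = solve-∀

    linearCombination≡ : ∀ a z → map ⟦_⟧ (linearCombination a z r s) ≡ word-g a z
    linearCombination≡ a z = cong₅ (e₀ M a z) (e₁ M a z) (e₂ M a z) (e₃ a z) (e₄ (pred N) a z)


-- Divisibility and parity

≈0⇒∣ : ∀ {a m} → a ≈ 0 [mod m ] → m ∣ a
≈0⇒∣ {a} {m} (multiples k l e) = ∣m+n∣m⇒∣n (subst (m ∣_) (trans (sym e) (+-comm a _)) (n∣m*n l)) (n∣m*n k)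

≈-weaken : ∀ {a b} c {m} → a ≈ b [mod c * m ] → a ≈ b [mod m ]
≈-weaken {a} {b} c {m} (multiples k l e) =
  multiples (k * c) (l * c) (trans (cong (_+_ a) (*-assoc k c m)) (trans e (cong (_+_ b) (sym (*-assoc l c m)))))

even⊎odd : ∀ n → n ≈ 0 [mod 2 ] ⊎ n ≈ 1 [mod 2 ]
even⊎odd n with n % 2 | m%n<n n 2 | %-≈ n 2
... | 0 | _ | e = inj₁ (≈-sym e)
... | 1 | _ | e = inj₂ (≈-sym e)
... | suc (suc _) | s≤s (s≤s ()) | _

lcm-idem : ∀ n → lcm n n ≡ n
lcm-idem n = ∣-antisym (lcm-least ∣-refl ∣-refl) (m∣lcm[m,n] n n)

-- Direct sums of codes over the same ring

module _ {N : ℕ} .{{_ : NonZero N}} {n₁ n₂ : ℕ} .{{_ : NonZero n₁}} .{{_ : NonZero n₂}} where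

  -- With both summands over ℤ/N the common modulus is `lcm N N`, equal to N, and both scaling
  -- factors are 1, so ⊕ is plain concatenation.
  isDirectSum : ∀ {C : WordSet N (n₁ + n₂)} {C₁ : WordSet N n₁} {C₂ : WordSet N n₂} →
                IsLinearCode C₁ → IsLinearCode C₂ →
                (∀ c → C c ⇔ (Σ[ c₁ ∈ Word N n₁ ] Σ[ c₂ ∈ Word N n₂ ] C₁ c₁ × C₂ c₂ × c ≡ c₁ ++ c₂)) →
                IsDirectSum C
  isDirectSum {C} {C₁} {C₂} lin₁ lin₂ C⇔ = record
    { C₁ = C₁ ; C₂ = C₂ ; C₁-linear = lin₁ ; C₂-linear = lin₂
    ; lcm≡N = lcm-idem N ; n₁+n₂≡n = refl
    ; C≅C₁⊕C₂ = Perm.id , λ c → transported (lcm N N) (lcm-idem N) {{lcm≢0 N N}} c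
    }
    where
    scale-id : ∀ {n} (c : Word N n) → map (scale N N) c ≡ c
    scale-id []      = refl
    scale-id (a ∷ c) = cong₂ _∷_
      (trans (cong (λ k → ⟦ k * toℕ a ⟧) (n/n≡1 N)) (trans (cong ⟦_⟧ (*-identityˡ (toℕ a))) (⟦toℕ⟧ a)))
      (scale-id c)

    -- `lcm N N` is generalised to a variable `L`, so that the transport along `lcm-idem N`
    -- disappears by matching on `refl`.
    transported : ∀ L (L≡N : L ≡ N) .{{_ : NonZero L}} c → C c ⇔
      subst₂ WordSet L≡N refl
        (λ c → Σ[ c₁ ∈ Word N n₁ ] Σ[ c₂ ∈ Word N n₂ ] C₁ c₁ × C₂ c₂ × c ≡ map (scale N L) c₁ ++ map (scale N L) c₂)
        (permute Perm.id c)
    transported L refl c rewrite tabulate∘lookup c = mk⇔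
      (λ c∈ → let c₁ , c₂ , m₁ , m₂ , e = Equivalence.to (C⇔ c) c∈
              in c₁ , c₂ , m₁ , m₂ , trans e (sym (cong₂ _++_ (scale-id c₁) (scale-id c₂))))
      (λ { (c₁ , c₂ , m₁ , m₂ , e) →
           Equivalence.from (C⇔ c) (c₁ , c₂ , m₁ , m₂ , trans e (cong₂ _++_ (scale-id c₁) (scale-id c₂))) })

-- Power series

increment : ∀ {m} → Vec ℕ (suc m) → Vec ℕ (suc m)
increment (x ∷ xs) = suc x ∷ xs

increment-injective : ∀ {m} {xs ys : Vec ℕ (suc m)} → increment xs ≡ increment ys → xs ≡ ys
increment-injective {xs = _ ∷ _} {_ ∷ _} refl = refl

-- Splitting on whether the first coordinate is zero gives Pascal's recursion: the counts for
-- `suc m` at `suc k` and at `k` differ by the count for `m` at `suc k`. This is exactly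
-- multiplication of 1/(1-t)^(m+1) by 1 - t.
compositions : ∀ m → ℕ → List (Vec ℕ m)
compositions zero    zero    = [] ∷ []
compositions zero    (suc k) = []
compositions (suc m) zero    = List.map (0 ∷_) (compositions m zero)
compositions (suc m) (suc k) =
  List.map (0 ∷_) (compositions m (suc k)) List.++ List.map increment (compositions (suc m) k)

∈-compositions⁺ : ∀ {m} (xs : Vec ℕ m) → xs ∈ compositions m (sum xs)
∈-compositions⁺ []             = here refl
∈-compositions⁺ (suc x ∷ xs)   = ∈-++⁺ʳ _ (∈-map⁺ increment (∈-compositions⁺ (x ∷ xs)))
∈-compositions⁺ (zero ∷ xs)    with sum xs | ∈-compositions⁺ xs
... | zero  | xs∈ = ∈-map⁺ (0 ∷_) xs∈
... | suc _ | xs∈ = ∈-++⁺ˡ (∈-map⁺ (0 ∷_) xs∈)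

∈-compositions⁻ : ∀ m k {xs : Vec ℕ m} → xs ∈ compositions m k → sum xs ≡ k
∈-compositions⁻ zero zero (here refl) = refl
∈-compositions⁻ (suc m) zero xs∈ with _ , ys∈ , refl ← ∈-map⁻ (0 ∷_) xs∈ = ∈-compositions⁻ m zero ys∈
∈-compositions⁻ (suc m) (suc k) xs∈ with ∈-++⁻ (List.map (0 ∷_) (compositions m (suc k))) xs∈
... | inj₁ xs∈₁ with _ , ys∈ , refl ← ∈-map⁻ (0 ∷_) xs∈₁ = ∈-compositions⁻ m (suc k) ys∈
... | inj₂ xs∈₂ with _ ∷ _ , ys∈ , refl ← ∈-map⁻ increment xs∈₂ = cong suc (∈-compositions⁻ (suc m) k ys∈)

compositions-unique : ∀ m k → Unique (compositions m k)
compositions-unique zero    zero    = [] ∷ []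
compositions-unique zero    (suc k) = []
compositions-unique (suc m) zero    = Unique.map⁺ ∷-injectiveʳ (compositions-unique m zero)
compositions-unique (suc m) (suc k) = Unique.++⁺
  (Unique.map⁺ ∷-injectiveʳ (compositions-unique m (suc k)))
  (Unique.map⁺ increment-injective (compositions-unique (suc m) k))
  λ { (xs∈₁ , xs∈₂) → disjoint (∈-map⁻ (0 ∷_) xs∈₁) (∈-map⁻ increment xs∈₂) }
  where
  disjoint : ∀ {xs} → Σ[ ys ∈ Vec ℕ m ] (ys ∈ compositions m (suc k) × xs ≡ 0 ∷ ys) →
             Σ[ ys ∈ Vec ℕ (suc m) ] (ys ∈ compositions (suc m) k × xs ≡ increment ys) → ⊥
  disjoint (_ , _ , refl) (_ ∷ _ , _ , ())

-- The vectors in ℕᵐ with coordinate sum k − w, none if k < w.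
deficient : ∀ m → ℕ → ℕ → List (Vec ℕ m)
deficient m zero    k       = compositions m k
deficient m (suc w) zero    = []
deficient m (suc w) (suc k) = deficient m w k

∈-deficient⁺ : ∀ {m} w (xs : Vec ℕ m) → xs ∈ deficient m w (w + sum xs)
∈-deficient⁺ zero    xs = ∈-compositions⁺ xs
∈-deficient⁺ (suc w) xs = ∈-deficient⁺ w xs

∈-deficient⁻ : ∀ m w k {xs : Vec ℕ m} → xs ∈ deficient m w k → w + sum xs ≡ k
∈-deficient⁻ m zero    k       xs∈ = ∈-compositions⁻ m k xs∈
∈-deficient⁻ m (suc w) (suc k) xs∈ = cong suc (∈-deficient⁻ m w k xs∈)

deficient-unique : ∀ m w k → Unique (deficient m w k)
deficient-unique m zero    k       = compositions-unique m k
deficient-unique m (suc w) zero    = []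
deficient-unique m (suc w) (suc k) = deficient-unique m w k

⊛-congˡ : ∀ {f f′ g} → f ≗ f′ → (f ⊛ g) ≗ (f′ ⊛ g)
⊛-congˡ {g = g} f≗ k = sumℤ-cong {suc k} λ i → cong (ℤ._* g (k ∸ toℕ i)) (f≗ (toℕ i))

⊛-congʳ : ∀ {f g g′} → g ≗ g′ → (f ⊛ g) ≗ (f ⊛ g′)
⊛-congʳ {f} g≗ k = sumℤ-cong {suc k} λ i → cong (f (toℕ i) ℤ.*_) (g≗ (k ∸ toℕ i))

⊛-zeroˡ : ∀ {n} (g : Fin n → ℤ) → sumℤ (λ i → 0ℤ ℤ.* g i) ≡ 0ℤ
⊛-zeroˡ {n} g = trans (sumℤ-cong {n} (λ i → ℤ.*-zeroˡ (g i))) (sumℤ-zero n)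

⊛-identityˡ : ∀ f → (fromCoeffs (1ℤ ∷ []) ⊛ f) ≗ f
⊛-identityˡ f k = trans (cong₂ ℤ._+_ (ℤ.*-identityˡ (f k)) (⊛-zeroˡ {k} (λ i → f (k ∸ suc (toℕ i))))) (ℤ.+-identityʳ (f k))

1-t⊛-zero : ∀ f → (1-t ⊛ f) 0 ≡ f 0
1-t⊛-zero f = trans (ℤ.+-identityʳ _) (ℤ.*-identityˡ (f 0))

1-t⊛-suc : ∀ f k → (1-t ⊛ f) (suc k) ≡ f (suc k) ℤ.- f k
1-t⊛-suc f k = cong₂ ℤ._+_ (ℤ.*-identityˡ (f (suc k)))
  (trans (cong₂ ℤ._+_ (ℤ.-1*i≡-i (f k)) (⊛-zeroˡ {k} (λ i → f (k ∸ suc (toℕ i))))) (ℤ.+-identityʳ _))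

1-t⊛-+ : ∀ f g → (1-t ⊛ (λ k → f k ℤ.+ g k)) ≗ (λ k → (1-t ⊛ f) k ℤ.+ (1-t ⊛ g) k)
1-t⊛-+ f g zero rewrite 1-t⊛-zero (λ k → f k ℤ.+ g k) | 1-t⊛-zero f | 1-t⊛-zero g = refl
1-t⊛-+ f g (suc k) rewrite 1-t⊛-suc (λ k → f k ℤ.+ g k) k | 1-t⊛-suc f k | 1-t⊛-suc g k =
  rearrange (f (suc k)) (g (suc k)) (f k) (g k)
  where
  rearrange : ∀ a b c d → (a ℤ.+ b) ℤ.- (c ℤ.+ d) ≡ (a ℤ.- c) ℤ.+ (b ℤ.- d)
  rearrange = ℤ.solve-∀

-- Multiplication by 1 - t takes differences of neighbouring coefficients, so this case of
-- associativity reduces to linearity of the convolution in its left factor.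
1-t⊛-assoc : ∀ f g → ((1-t ⊛ f) ⊛ g) ≗ (1-t ⊛ (f ⊛ g))
1-t⊛-assoc f g zero = trans (cong (λ a → a ℤ.* g 0 ℤ.+ 0ℤ) (1-t⊛-zero f)) (sym (1-t⊛-zero (f ⊛ g)))
1-t⊛-assoc f g (suc k) = begin
  (1-t ⊛ f) 0 ℤ.* g (suc k) ℤ.+ (((1-t ⊛ f) ∘ suc) ⊛ g) k
    ≡⟨ cong₂ ℤ._+_ (cong (ℤ._* g (suc k)) (1-t⊛-zero f)) (⊛-congˡ {g = g} (1-t⊛-suc f) k) ⟩
  f 0 ℤ.* g (suc k) ℤ.+ ((λ k → f (suc k) ℤ.- f k) ⊛ g) k
    ≡⟨ cong (λ a → f 0 ℤ.* g (suc k) ℤ.+ a) distribute ⟩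
  f 0 ℤ.* g (suc k) ℤ.+ (((f ∘ suc) ⊛ g) k ℤ.- (f ⊛ g) k)
    ≡⟨ ℤ.+-assoc (f 0 ℤ.* g (suc k)) _ _ ⟨
  (f ⊛ g) (suc k) ℤ.- (f ⊛ g) k
    ≡⟨ 1-t⊛-suc (f ⊛ g) k ⟨
  (1-t ⊛ (f ⊛ g)) (suc k)
    ∎
  where
  open ≡-Reasoning
  split : ∀ a b c → (a ℤ.- b) ℤ.* c ≡ a ℤ.* c ℤ.+ -1ℤ ℤ.* (b ℤ.* c)
  split = ℤ.solve-∀
  distribute : ((λ k → f (suc k) ℤ.- f k) ⊛ g) k ≡ ((f ∘ suc) ⊛ g) k ℤ.- (f ⊛ g) k
  distribute = begin
    ((λ k → f (suc k) ℤ.- f k) ⊛ g) k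
      ≡⟨ sumℤ-cong {suc k} (λ i → split (f (suc (toℕ i))) (f (toℕ i)) (g (k ∸ toℕ i))) ⟩
    sumℤ {suc k} (λ i → f (suc (toℕ i)) ℤ.* g (k ∸ toℕ i) ℤ.+ -1ℤ ℤ.* (f (toℕ i) ℤ.* g (k ∸ toℕ i)))
      ≡⟨ sumℤ-distrib-+ {suc k} (λ i → f (suc (toℕ i)) ℤ.* g (k ∸ toℕ i)) (λ i → -1ℤ ℤ.* (f (toℕ i) ℤ.* g (k ∸ toℕ i))) ⟩
    ((f ∘ suc) ⊛ g) k ℤ.+ sumℤ {suc k} (λ i → -1ℤ ℤ.* (f (toℕ i) ℤ.* g (k ∸ toℕ i)))
      ≡⟨ cong (λ a → ((f ∘ suc) ⊛ g) k ℤ.+ a) (trans (sym (*-distribˡ-sumℤ {suc k} -1ℤ (λ i → f (toℕ i) ℤ.* g (k ∸ toℕ i)))) (ℤ.-1*i≡-i _)) ⟩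
    ((f ∘ suc) ⊛ g) k ℤ.- (f ⊛ g) k
      ∎

-- t^w / (1-t)^m, by `1-t⊛-shiftedSeries` below.
shiftedSeries : ℕ → ℕ → PowerSeries
shiftedSeries m w k = + length (deficient m w k)

1-t⊛-shiftedSeries : ∀ m w → (1-t ⊛ shiftedSeries (suc m) w) ≗ shiftedSeries m w
1-t⊛-shiftedSeries m zero zero =
  trans (1-t⊛-zero (shiftedSeries (suc m) 0)) (cong +_ (length-map (0 ∷_) (compositions m 0)))
1-t⊛-shiftedSeries m zero (suc k) = begin
  (1-t ⊛ shiftedSeries (suc m) 0) (suc k)
    ≡⟨ 1-t⊛-suc (shiftedSeries (suc m) 0) k ⟩
  + length (List.map (0 ∷_) xs List.++ List.map increment ys) ℤ.- + length ys
    ≡⟨ cong (λ n → + n ℤ.- + length ys) (trans (length-++ (List.map (0 ∷_) xs)) (cong₂ _+_ (length-map _ xs) (length-map increment ys))) ⟩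
  (+ length xs ℤ.+ + length ys) ℤ.- + length ys
    ≡⟨ cancel (+ length xs) (+ length ys) ⟩
  + length xs
    ∎
  where
  open ≡-Reasoning
  xs = compositions m (suc k)
  ys = compositions (suc m) k
  cancel : ∀ a b → (a ℤ.+ b) ℤ.- b ≡ a
  cancel = ℤ.solve-∀
1-t⊛-shiftedSeries m (suc w) zero = 1-t⊛-zero (shiftedSeries (suc m) (suc w))
-- The subtracted coefficient has degree 0 and vanishes because of the shift, so both sides reduce
-- to the degree 0 case for `w`.
1-t⊛-shiftedSeries m (suc w) (suc zero) =
  trans (1-t⊛-suc (shiftedSeries (suc m) (suc w)) 0)
    (trans (ℤ.+-identityʳ _) (trans (sym (1-t⊛-zero (shiftedSeries (suc m) w))) (1-t⊛-shiftedSeries m w 0)))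
1-t⊛-shiftedSeries m (suc w) (suc (suc k)) =
  trans (1-t⊛-suc (shiftedSeries (suc m) (suc w)) (suc k))
    (trans (sym (1-t⊛-suc (shiftedSeries (suc m) w) k)) (1-t⊛-shiftedSeries m w (suc k)))

-- (Σ_{w ∈ ws} t^w) / (1-t)^m
weightSeries : ℕ → List ℕ → PowerSeries
weightSeries m []       k = 0ℤ
weightSeries m (w ∷ ws) k = shiftedSeries m w k ℤ.+ weightSeries m ws k

1-t⊛-weightSeries : ∀ m ws → (1-t ⊛ weightSeries (suc m) ws) ≗ weightSeries m ws
1-t⊛-weightSeries m []       zero    = refl
1-t⊛-weightSeries m []       (suc k) = 1-t⊛-suc (weightSeries (suc m) []) k
1-t⊛-weightSeries m (w ∷ ws) k       = trans (1-t⊛-+ (shiftedSeries (suc m) w) (weightSeries (suc m) ws) k)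
  (cong₂ ℤ._+_ (1-t⊛-shiftedSeries m w k) (1-t⊛-weightSeries m ws k))

-- The remaining exponent `j` varies in the induction: the inner power of 1 - t cancels first and
-- leaves exponent `suc j` for the outermost factor.
1-t^⊛-weightSeries : ∀ m j ws → ((1-t ^⊛ m) ⊛ weightSeries (m + j) ws) ≗ weightSeries j ws
1-t^⊛-weightSeries zero    j ws k = ⊛-identityˡ (weightSeries j ws) k
1-t^⊛-weightSeries (suc m) j ws k = begin
  ((1-t ⊛ (1-t ^⊛ m)) ⊛ weightSeries (suc m + j) ws) k   ≡⟨ 1-t⊛-assoc (1-t ^⊛ m) (weightSeries (suc m + j) ws) k ⟩
  (1-t ⊛ ((1-t ^⊛ m) ⊛ weightSeries (suc m + j) ws)) k   ≡⟨ cong (λ i → (1-t ⊛ ((1-t ^⊛ m) ⊛ weightSeries i ws)) k) (+-suc m j) ⟨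
  (1-t ⊛ ((1-t ^⊛ m) ⊛ weightSeries (m + suc j) ws)) k   ≡⟨ ⊛-congʳ {1-t} (1-t^⊛-weightSeries m (suc j) ws) k ⟩
  (1-t ⊛ weightSeries (suc j) ws) k                      ≡⟨ 1-t⊛-weightSeries j ws k ⟩
  weightSeries j ws k                                    ∎
  where open ≡-Reasoning

-- Multiplication by 1 - t preserves the constant coefficient. This serves to match the constant
-- term that `ehrhartSeries` prescribes.
weightSeries-zero : ∀ m ws → weightSeries m ws 0 ≡ weightSeries 0 ws 0
weightSeries-zero zero    ws = refl
weightSeries-zero (suc m) ws = trans (sym (1-t⊛-zero (weightSeries (suc m) ws)))
  (trans (1-t⊛-weightSeries m ws 0) (weightSeries-zero m ws))

weightSeries-++ : ∀ m ws vs k → weightSeries m (ws List.++ vs) k ≡ weightSeries m ws k ℤ.+ weightSeries m vs k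
weightSeries-++ m []       vs k = sym (ℤ.+-identityˡ _)
weightSeries-++ m (w ∷ ws) vs k = trans (cong (λ s → shiftedSeries m w k ℤ.+ s) (weightSeries-++ m ws vs k))
  (sym (ℤ.+-assoc (shiftedSeries m w k) (weightSeries m ws k) (weightSeries m vs k)))

-- Series of explicit weight lists

alternate : ℕ → ℕ → ℕ → ℕ
alternate u v zero          = u
alternate u v (suc zero)    = v
alternate u v (suc (suc n)) = alternate u v n

alternate-even : ∀ u v j → alternate u v (j * 2) ≡ u
alternate-even u v zero    = refl
alternate-even u v (suc j) = alternate-even u v j

alternate-odd : ∀ u v j → alternate u v (suc (j * 2)) ≡ v
alternate-odd u v zero    = refl
alternate-odd u v (suc j) = alternate-odd u v j

twice⊎suc-twice : ∀ n → (∃[ j ] n ≡ j * 2) ⊎ (∃[ j ] n ≡ suc (j * 2))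
twice⊎suc-twice zero = inj₁ (0 , refl)
twice⊎suc-twice (suc n) with twice⊎suc-twice n
... | inj₁ (j , refl) = inj₂ (j , refl)
... | inj₂ (j , refl) = inj₁ (suc j , refl)

-- The length is odd because there are N - 1 nonzero residues modulo N, with `j` = M - 1; hence `u`
-- occurs once more than `v`.
weightSeries-alternate : ∀ m u v j k → weightSeries m (applyUpTo (alternate u v) (suc (j * 2))) k ≡
                         (1ℤ ℤ.+ + j) ℤ.* shiftedSeries m u k ℤ.+ + j ℤ.* shiftedSeries m v k
weightSeries-alternate m u v zero    k = base (shiftedSeries m u k) (shiftedSeries m v k)
  where
  base : ∀ x y → x ℤ.+ 0ℤ ≡ (1ℤ ℤ.+ 0ℤ) ℤ.* x ℤ.+ 0ℤ ℤ.* y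
  base = ℤ.solve-∀
weightSeries-alternate m u v (suc j) k =
  trans (cong (λ s → shiftedSeries m u k ℤ.+ (shiftedSeries m v k ℤ.+ s)) (weightSeries-alternate m u v j k))
    (step (+ j) (shiftedSeries m u k) (shiftedSeries m v k))
  where
  step : ∀ j x y → x ℤ.+ (y ℤ.+ ((1ℤ ℤ.+ j) ℤ.* x ℤ.+ j ℤ.* y)) ≡ (1ℤ ℤ.+ (1ℤ ℤ.+ j)) ℤ.* x ℤ.+ (1ℤ ℤ.+ j) ℤ.* y
  step = ℤ.solve-∀

weightSeries-const : ∀ m w n k → weightSeries m (applyUpTo (λ _ → w) n) k ≡ + n ℤ.* shiftedSeries m w k
weightSeries-const m w zero    k = refl
weightSeries-const m w (suc n) k = trans (cong (λ s → shiftedSeries m w k ℤ.+ s) (weightSeries-const m w n k))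
  (step (+ n) (shiftedSeries m w k))
  where
  step : ∀ n x → x ℤ.+ n ℤ.* x ≡ (1ℤ ℤ.+ n) ℤ.* x
  step = ℤ.solve-∀

tabulate-applyUpTo : ∀ {A : Set} n {f : Fin n → A} {g : ℕ → A} → (∀ i → f i ≡ g (toℕ i)) → List.tabulate f ≡ applyUpTo g n
tabulate-applyUpTo zero    f≗g = refl
tabulate-applyUpTo (suc n) f≗g = cong₂ _∷_ (f≗g zero) (tabulate-applyUpTo n (f≗g ∘ suc))

-- Lattice points of the simplex of a code

-- The division in `toℚ` normalises through a gcd that is stuck on a variable; the explicit fraction
-- with denominator 1 lets order and arithmetic compute.
toℚ-mkℚ : ∀ z → toℚ z ≡ mkℚ z 0 (Coprime.sym (Coprime.1-coprimeTo ℤ.∣ z ∣))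
toℚ-mkℚ z = ℚ.↥p/↧p≡p (mkℚ z 0 (Coprime.sym (Coprime.1-coprimeTo ℤ.∣ z ∣)))

toℚ-injective : ∀ {a b} → toℚ a ≡ toℚ b → a ≡ b
toℚ-injective {a} {b} e = cong ℚ.↥_ (trans (sym (toℚ-mkℚ a)) (trans e (toℚ-mkℚ b)))

toℚ-+ : ∀ a b → toℚ (a ℤ.+ b) ≡ toℚ a ℚ.+ toℚ b
toℚ-+ a b rewrite toℚ-mkℚ a | toℚ-mkℚ b = cong toℚ (sym (cong₂ ℤ._+_ (ℤ.*-identityʳ a) (ℤ.*-identityʳ b)))

toℚ-* : ∀ a b → toℚ (a ℤ.* b) ≡ toℚ a ℚ.* toℚ b
toℚ-* a b rewrite toℚ-mkℚ a | toℚ-mkℚ b = refl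

0≤toℚ⁻ : ∀ {a} → 0ℚ ℚ.≤ toℚ a → 0ℤ ℤ.≤ a
0≤toℚ⁻ {a} 0≤ rewrite toℚ-mkℚ a with *≤* 0≤a*1 ← 0≤ = subst (0ℤ ℤ.≤_) (ℤ.*-identityʳ a) 0≤a*1

toℚ-nonNegative : ∀ n → ℚ.NonNegative (toℚ (+ n))
toℚ-nonNegative n rewrite toℚ-mkℚ (+ n) = _

toℚ-positive : ∀ n .{{_ : NonZero n}} → ℚ.Positive (toℚ (+ n))
toℚ-positive (suc n) rewrite toℚ-mkℚ (+ suc n) = _

positive-inverse : ∀ n .{{_ : NonZero n}} → Σ[ r ∈ ℚ ] ℚ.NonNegative r × r ℚ.* toℚ (+ n) ≡ 1ℚ
positive-inverse n = (ℚ.1/ toℚ (+ n)) , ℚ.pos⇒nonNeg (ℚ.1/ toℚ (+ n)) {{ℚ.1/pos⇒pos (toℚ (+ n))}} , ℚ.*-inverseˡ (toℚ (+ n))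
  where instance
    n>0 = toℚ-positive n
    n≢0 = ℚ.pos⇒nonZero (toℚ (+ n))

sumℚ-toℚ : ∀ {n} (y : Vec ℕ n) → sumℚ (λ j → toℚ (+ lookup y j)) ≡ toℚ (+ sum y)
sumℚ-toℚ []      = refl
sumℚ-toℚ (a ∷ y) = trans (cong (λ □ → toℚ (+ a) ℚ.+ □) (sumℚ-toℚ y)) (sym (toℚ-+ (+ a) (+ sum y)))

diagonal : ∀ {n} → ℕ → Fin n → Fin n → ℤ
diagonal N i j = if does (i ≟ j) then + N else 0ℤ

sumℚ-*0 : ∀ {n} (f : Fin n → ℚ) → sumℚ (λ i → f i ℚ.* 0ℚ) ≡ 0ℚ
sumℚ-*0 {n} f = trans (sumℚ-cong {n} (λ i → ℚ.*-zeroʳ (f i))) (sumℚ-zero n)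

sumℚ-diagonal : ∀ {n} N (f : Fin n → ℚ) j → sumℚ (λ i → f i ℚ.* toℚ (diagonal N i j)) ≡ f j ℚ.* toℚ (+ N)
sumℚ-diagonal N f zero    = trans (cong (λ □ → f zero ℚ.* toℚ (+ N) ℚ.+ □) (sumℚ-*0 (f ∘ suc))) (ℚ.+-identityʳ _)
sumℚ-diagonal N f (suc j) = trans (cong₂ ℚ._+_ (ℚ.*-zeroʳ (f zero)) (sumℚ-diagonal N (f ∘ suc) j)) (ℚ.+-identityˡ _)

lookup-extensional : ∀ {A : Set} {n} {x y : Vec A n} → (∀ i → lookup x i ≡ lookup y i) → x ≡ y
lookup-extensional {x = x} {y} e = trans (sym (tabulate∘lookup x)) (trans (tabulate-cong e) (tabulate∘lookup y))

-- Dilates of the simplex in barycentric coordinates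

module _ {N d : ℕ} .{{_ : NonZero N}} where

  vertices : Vec (Point (suc d)) (suc d)
  vertices = tabulate (Ne N)

  lookup-vertices : ∀ i j → lookup (lookup vertices i) j ≡ diagonal N i j
  lookup-vertices i j = trans (cong (λ v → lookup v j) (lookup∘tabulate (Ne N) i)) (lookup∘tabulate (diagonal N i) j)

  -- Dilation by k+1 with centre N e₀ moves the simplex by − k N e₀ relative to dilation with centre 0.
  translate : ℕ → Vec ℕ (suc d) → Point (suc d)
  translate k y = tabulate λ j → + lookup y j ℤ.- + k ℤ.* diagonal N zero j

  lookup-translate : ∀ k y j → lookup (translate k y) j ≡ + lookup y j ℤ.- + k ℤ.* diagonal N zero j
  lookup-translate k y = lookup∘tabulate λ j → + lookup y j ℤ.- + k ℤ.* diagonal N zero j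

  lookup-dilate : ∀ k i j → lookup (lookup (map (dilate (Ne N zero) (suc k)) vertices) i) j ≡
                            ℤ.- (+ k ℤ.* diagonal N zero j) ℤ.+ + suc k ℤ.* diagonal N i j
  lookup-dilate k i j = begin
    lookup (lookup (map (dilate (Ne N zero) (suc k)) vertices) i) j
      ≡⟨ cong (λ v → lookup v j) (lookup-map i (dilate (Ne N zero) (suc k)) vertices) ⟩
    lookup (dilate (Ne N zero) (suc k) (lookup vertices i)) j
      ≡⟨ lookup-zipWith _ j (Ne N zero) (lookup vertices i) ⟩
    lookup (Ne N zero) j ℤ.+ + suc k ℤ.* (lookup (lookup vertices i) j ℤ.- lookup (Ne N zero) j)
      ≡⟨ cong₂ (λ a b → a ℤ.+ + suc k ℤ.* (b ℤ.- a)) (lookup∘tabulate (diagonal N zero) j) (lookup-vertices i j) ⟩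
    diagonal N zero j ℤ.+ + suc k ℤ.* (diagonal N i j ℤ.- diagonal N zero j)
      ≡⟨ regroup (+ k) (diagonal N zero j) (diagonal N i j) ⟩
    ℤ.- (+ k ℤ.* diagonal N zero j) ℤ.+ + suc k ℤ.* diagonal N i j
      ∎
    where
    open ≡-Reasoning
    regroup : ∀ k a b → a ℤ.+ (1ℤ ℤ.+ k) ℤ.* (b ℤ.- a) ≡ ℤ.- (k ℤ.* a) ℤ.+ (1ℤ ℤ.+ k) ℤ.* b
    regroup = ℤ.solve-∀

  -- As the coefficients sum to 1, the common translation comes out of the combination unchanged.
  -- The rest is a multiple of a diagonal matrix, so coordinate `j` determines `μ j`.
  combination-dilate : ∀ k (μ : Fin (suc d) → ℚ) → sumℚ μ ≡ 1ℚ → ∀ j →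
    sumℚ (λ i → μ i ℚ.* toℚ (lookup (lookup (map (dilate (Ne N zero) (suc k)) vertices) i) j)) ≡
    toℚ (ℤ.- (+ k ℤ.* diagonal N zero j)) ℚ.+ μ j ℚ.* toℚ (+ (suc k * N))
  combination-dilate k μ sum≡1 j = begin
    sumℚ (λ i → μ i ℚ.* toℚ (lookup (lookup (map (dilate (Ne N zero) (suc k)) vertices) i) j))
      ≡⟨ sumℚ-cong {suc d} expand ⟩
    sumℚ (λ i → μ i ℚ.* A ℚ.+ μ i ℚ.* toℚ (diagonal N i j) ℚ.* K)
      ≡⟨ sumℚ-distrib-+ (λ i → μ i ℚ.* A) (λ i → μ i ℚ.* toℚ (diagonal N i j) ℚ.* K) ⟩
    sumℚ (λ i → μ i ℚ.* A) ℚ.+ sumℚ (λ i → μ i ℚ.* toℚ (diagonal N i j) ℚ.* K)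
      ≡⟨ cong₂ ℚ._+_ (*-distribʳ-sumℚ A μ) (*-distribʳ-sumℚ K (λ i → μ i ℚ.* toℚ (diagonal N i j))) ⟨
    sumℚ μ ℚ.* A ℚ.+ sumℚ (λ i → μ i ℚ.* toℚ (diagonal N i j)) ℚ.* K
      ≡⟨ cong₂ (λ a b → a ℚ.* A ℚ.+ b ℚ.* K) sum≡1 (sumℚ-diagonal N μ j) ⟩
    1ℚ ℚ.* A ℚ.+ μ j ℚ.* toℚ (+ N) ℚ.* K
      ≡⟨ cong₂ ℚ._+_ (ℚ.*-identityˡ A) (trans (ℚ.*-assoc (μ j) _ K) (cong (μ j ℚ.*_) NK≡)) ⟩
    A ℚ.+ μ j ℚ.* toℚ (+ (suc k * N))
      ∎
    where
    open ≡-Reasoning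
    A = toℚ (ℤ.- (+ k ℤ.* diagonal N zero j))
    K = toℚ (+ suc k)
    NK≡ : toℚ (+ N) ℚ.* K ≡ toℚ (+ (suc k * N))
    NK≡ = trans (ℚ.*-comm (toℚ (+ N)) K) (trans (sym (toℚ-* (+ suc k) (+ N))) (cong toℚ (sym (ℤ.pos-* (suc k) N))))
    expand : ∀ i → μ i ℚ.* toℚ (lookup (lookup (map (dilate (Ne N zero) (suc k)) vertices) i) j) ≡
                   μ i ℚ.* A ℚ.+ μ i ℚ.* toℚ (diagonal N i j) ℚ.* K
    expand i = begin
      μ i ℚ.* toℚ (lookup (lookup (map (dilate (Ne N zero) (suc k)) vertices) i) j)
        ≡⟨ cong (λ z → μ i ℚ.* toℚ z) (lookup-dilate k i j) ⟩
      μ i ℚ.* toℚ (ℤ.- (+ k ℤ.* diagonal N zero j) ℤ.+ + suc k ℤ.* diagonal N i j)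
        ≡⟨ cong (μ i ℚ.*_) (trans (toℚ-+ (ℤ.- (+ k ℤ.* diagonal N zero j)) (+ suc k ℤ.* diagonal N i j))
             (cong (A ℚ.+_) (trans (toℚ-* (+ suc k) (diagonal N i j)) (ℚ.*-comm K _)))) ⟩
      μ i ℚ.* (A ℚ.+ toℚ (diagonal N i j) ℚ.* K)
        ≡⟨ ℚ.*-distribˡ-+ (μ i) A _ ⟩
      μ i ℚ.* A ℚ.+ μ i ℚ.* (toℚ (diagonal N i j) ℚ.* K)
        ≡⟨ cong (λ □ → μ i ℚ.* A ℚ.+ □) (ℚ.*-assoc (μ i) _ K) ⟨
      μ i ℚ.* A ℚ.+ μ i ℚ.* toℚ (diagonal N i j) ℚ.* K
        ∎

  toℚ-translate : ∀ k a v → toℚ (+ a ℤ.- + k ℤ.* v) ≡ toℚ (ℤ.- (+ k ℤ.* v)) ℚ.+ toℚ (+ a)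
  toℚ-translate k a v = trans (toℚ-+ (+ a) (ℤ.- (+ k ℤ.* v))) (ℚ.+-comm (toℚ (+ a)) _)

  -- Undoing the translation leaves the integers μ_j (k+1) N. They are nonnegative, so the absolute
  -- values in `y` lose nothing, and they sum to (k+1) N because the μ_j sum to 1.
  ∈conv-dilate⁻ : ∀ k {x} → x ∈conv map (dilate (Ne N zero) (suc k)) vertices →
                  Σ[ y ∈ Vec ℕ (suc d) ] x ≡ translate k y × sum y ≡ suc k * N
  ∈conv-dilate⁻ k {x} x∈ = y , lookup-extensional x≡ , sum-y
    where
    open ≡-Reasoning
    open _∈conv_ x∈
    open _∈aff_ affine renaming (coeff to μ)
    z : Fin (suc d) → ℤ
    z j = lookup x j ℤ.+ + k ℤ.* diagonal N zero j
    y : Vec ℕ (suc d)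
    y = tabulate λ j → ℤ.∣ z j ∣
    z-scaled : ∀ j → toℚ (z j) ≡ μ j ℚ.* toℚ (+ (suc k * N))
    z-scaled j = begin
      toℚ (lookup x j ℤ.+ B)                            ≡⟨ toℚ-+ (lookup x j) B ⟩
      toℚ (lookup x j) ℚ.+ toℚ B                        ≡⟨ cong (ℚ._+ toℚ B) (combine j) ⟨
      sumℚ (λ i → μ i ℚ.* toℚ (lookup (lookup (map (dilate (Ne N zero) (suc k)) vertices) i) j)) ℚ.+ toℚ B
                                                        ≡⟨ cong (ℚ._+ toℚ B) (combination-dilate k μ sum≡1 j) ⟩
      toℚ (ℤ.- B) ℚ.+ C ℚ.+ toℚ B                       ≡⟨ cong (ℚ._+ toℚ B) (ℚ.+-comm (toℚ (ℤ.- B)) C) ⟩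
      C ℚ.+ toℚ (ℤ.- B) ℚ.+ toℚ B                       ≡⟨ ℚ.+-assoc C _ _ ⟩
      C ℚ.+ (toℚ (ℤ.- B) ℚ.+ toℚ B)                     ≡⟨ cong (C ℚ.+_) (toℚ-+ (ℤ.- B) B) ⟨
      C ℚ.+ toℚ (ℤ.- B ℤ.+ B)                           ≡⟨ cong (λ b → C ℚ.+ toℚ b) (ℤ.+-inverseˡ B) ⟩
      C ℚ.+ 0ℚ                                          ≡⟨ ℚ.+-identityʳ C ⟩
      C                                                 ∎
      where
      B = + k ℤ.* diagonal N zero j
      C = μ j ℚ.* toℚ (+ (suc k * N))
    z≥0 : ∀ j → 0ℤ ℤ.≤ z j
    z≥0 j = 0≤toℚ⁻ (subst (0ℚ ℚ.≤_) (sym (z-scaled j))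
      (ℚ.nonNegative⁻¹ _ {{ℚ.nonNeg*nonNeg⇒nonNeg (μ j) {{ℚ.nonNegative (nonNegative j)}} (toℚ (+ (suc k * N))) {{toℚ-nonNegative (suc k * N)}}}}))
    +y≡z : ∀ j → + lookup y j ≡ z j
    +y≡z j = trans (cong +_ (lookup∘tabulate (λ j → ℤ.∣ z j ∣) j)) (ℤ.0≤i⇒+∣i∣≡i (z≥0 j))
    cancel : ∀ a b → a ≡ a ℤ.+ b ℤ.- b
    cancel = ℤ.solve-∀
    x≡ : ∀ j → lookup x j ≡ lookup (translate k y) j
    x≡ j = begin
      lookup x j                                     ≡⟨ cancel (lookup x j) (+ k ℤ.* diagonal N zero j) ⟩
      z j ℤ.- + k ℤ.* diagonal N zero j              ≡⟨ cong (ℤ._- + k ℤ.* diagonal N zero j) (+y≡z j) ⟨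
      + lookup y j ℤ.- + k ℤ.* diagonal N zero j     ≡⟨ lookup-translate k y j ⟨
      lookup (translate k y) j                       ∎
    sum-y : sum y ≡ suc k * N
    sum-y = ℤ.+-injective (toℚ-injective (begin
      toℚ (+ sum y)                                      ≡⟨ sumℚ-toℚ y ⟨
      sumℚ (λ j → toℚ (+ lookup y j))                    ≡⟨ sumℚ-cong {suc d} (λ j → trans (cong toℚ (+y≡z j)) (z-scaled j)) ⟩
      sumℚ (λ j → μ j ℚ.* toℚ (+ (suc k * N)))           ≡⟨ *-distribʳ-sumℚ (toℚ (+ (suc k * N))) μ ⟨
      sumℚ μ ℚ.* toℚ (+ (suc k * N))                     ≡⟨ cong (ℚ._* toℚ (+ (suc k * N))) sum≡1 ⟩
      1ℚ ℚ.* toℚ (+ (suc k * N))                         ≡⟨ ℚ.*-identityˡ _ ⟩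
      toℚ (+ (suc k * N))                                ∎))

  ∈conv-dilate⁺ : ∀ k y → sum y ≡ suc k * N → translate k y ∈conv map (dilate (Ne N zero) (suc k)) vertices
  ∈conv-dilate⁺ k y sum-y = record
    { affine = record { coeff = μ ; sum≡1 = sum≡1 ; combine = combine }
    ; nonNegative = λ j → ℚ.nonNegative⁻¹ (μ j) {{ℚ.nonNeg*nonNeg⇒nonNeg (toℚ (+ lookup y j)) {{toℚ-nonNegative (lookup y j)}} r {{r≥0}}}}
    }
    where
    open ≡-Reasoning
    inverse : Σ[ r ∈ ℚ ] ℚ.NonNegative r × r ℚ.* toℚ (+ (suc k * N)) ≡ 1ℚ
    inverse = positive-inverse (suc k * N) {{m*n≢0 (suc k) N}}
    r   = proj₁ inverse
    r≥0 = proj₁ (proj₂ inverse)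
    r-inverse = proj₂ (proj₂ inverse)
    μ : Fin (suc d) → ℚ
    -- The only possible choice by `combination-dilate`: y_j divided by (k+1) N.
    μ j = toℚ (+ lookup y j) ℚ.* r
    sum≡1 : sumℚ μ ≡ 1ℚ
    sum≡1 = begin
      sumℚ μ                                      ≡⟨ *-distribʳ-sumℚ r (λ j → toℚ (+ lookup y j)) ⟨
      sumℚ (λ j → toℚ (+ lookup y j)) ℚ.* r       ≡⟨ cong (ℚ._* r) (trans (sumℚ-toℚ y) (cong (λ s → toℚ (+ s)) sum-y)) ⟩
      toℚ (+ (suc k * N)) ℚ.* r                   ≡⟨ ℚ.*-comm _ r ⟩
      r ℚ.* toℚ (+ (suc k * N))                   ≡⟨ r-inverse ⟩
      1ℚ                                          ∎
    combine : ∀ j → sumℚ (λ i → μ i ℚ.* toℚ (lookup (lookup (map (dilate (Ne N zero) (suc k)) vertices) i) j)) ≡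
                    toℚ (lookup (translate k y) j)
    combine j = begin
      sumℚ (λ i → μ i ℚ.* toℚ (lookup (lookup (map (dilate (Ne N zero) (suc k)) vertices) i) j))
        ≡⟨ combination-dilate k μ sum≡1 j ⟩
      A ℚ.+ toℚ (+ lookup y j) ℚ.* r ℚ.* toℚ (+ (suc k * N))
        ≡⟨ cong (A ℚ.+_) (trans (ℚ.*-assoc (toℚ (+ lookup y j)) r _) (trans (cong (toℚ (+ lookup y j) ℚ.*_) r-inverse) (ℚ.*-identityʳ _))) ⟩
      A ℚ.+ toℚ (+ lookup y j)
        ≡⟨ toℚ-translate k (lookup y j) (diagonal N zero j) ⟨
      toℚ (+ lookup y j ℤ.- + k ℤ.* diagonal N zero j)
        ≡⟨ cong toℚ (lookup-translate k y j) ⟨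
      toℚ (lookup (translate k y) j)
        ∎
      where A = toℚ (ℤ.- (+ k ℤ.* diagonal N zero j))

  -- The affine hull of the vertices is the hyperplane of coordinate sum N, with affine coordinates
  -- x_j / N.
  ∈aff⁺ : ∀ x → sumℚ (λ j → toℚ (lookup x j)) ≡ toℚ (+ N) → x ∈aff vertices
  ∈aff⁺ x sum-x = record { coeff = λ j → toℚ (lookup x j) ℚ.* r ; sum≡1 = sum≡1 ; combine = combine }
    where
    open ≡-Reasoning
    inverse : Σ[ r ∈ ℚ ] ℚ.NonNegative r × r ℚ.* toℚ (+ N) ≡ 1ℚ
    inverse = positive-inverse N
    r = proj₁ inverse
    r-inverse = proj₂ (proj₂ inverse)
    sum≡1 : sumℚ (λ j → toℚ (lookup x j) ℚ.* r) ≡ 1ℚ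
    sum≡1 = begin
      sumℚ (λ j → toℚ (lookup x j) ℚ.* r)    ≡⟨ *-distribʳ-sumℚ r (λ j → toℚ (lookup x j)) ⟨
      sumℚ (λ j → toℚ (lookup x j)) ℚ.* r    ≡⟨ cong (ℚ._* r) sum-x ⟩
      toℚ (+ N) ℚ.* r                        ≡⟨ ℚ.*-comm _ r ⟩
      r ℚ.* toℚ (+ N)                        ≡⟨ r-inverse ⟩
      1ℚ                                     ∎
    combine : ∀ j → sumℚ (λ i → toℚ (lookup x i) ℚ.* r ℚ.* toℚ (lookup (lookup vertices i) j)) ≡ toℚ (lookup x j)
    combine j = begin
      sumℚ (λ i → toℚ (lookup x i) ℚ.* r ℚ.* toℚ (lookup (lookup vertices i) j))
        ≡⟨ sumℚ-cong {suc d} (λ i → cong (λ z → toℚ (lookup x i) ℚ.* r ℚ.* toℚ z) (lookup-vertices i j)) ⟩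
      sumℚ (λ i → toℚ (lookup x i) ℚ.* r ℚ.* toℚ (diagonal N i j))
        ≡⟨ sumℚ-diagonal N (λ i → toℚ (lookup x i) ℚ.* r) j ⟩
      toℚ (lookup x j) ℚ.* r ℚ.* toℚ (+ N)
        ≡⟨ trans (ℚ.*-assoc (toℚ (lookup x j)) r _) (cong (toℚ (lookup x j) ℚ.*_) r-inverse) ⟩
      toℚ (lookup x j) ℚ.* 1ℚ
        ≡⟨ ℚ.*-identityʳ _ ⟩
      toℚ (lookup x j)
        ∎

  -- (k+1) N - k N = N: dilation about a vertex stays in the affine hull of the simplex for every
  -- `k`.
  sumℚ-translate : ∀ k y → sum y ≡ suc k * N → sumℚ (λ j → toℚ (lookup (translate k y) j)) ≡ toℚ (+ N)
  sumℚ-translate k y sum-y = begin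
    sumℚ (λ j → toℚ (lookup (translate k y) j))
      ≡⟨ sumℚ-cong {suc d} expand ⟩
    sumℚ (λ j → toℚ (+ lookup y j) ℚ.+ K ℚ.* toℚ (diagonal N zero j))
      ≡⟨ sumℚ-distrib-+ {suc d} (λ j → toℚ (+ lookup y j)) (λ j → K ℚ.* toℚ (diagonal N zero j)) ⟩
    sumℚ (λ j → toℚ (+ lookup y j)) ℚ.+ sumℚ {suc d} (λ j → K ℚ.* toℚ (diagonal N zero j))
      ≡⟨ cong₂ ℚ._+_ (trans (sumℚ-toℚ y) (cong (λ s → toℚ (+ s)) sum-y))
           (cong (K ℚ.* toℚ (+ N) ℚ.+_) (sumℚ-*0 {d} (λ _ → K))) ⟩
    toℚ (+ (suc k * N)) ℚ.+ (K ℚ.* toℚ (+ N) ℚ.+ 0ℚ)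
      ≡⟨ cong (toℚ (+ (suc k * N)) ℚ.+_) (trans (ℚ.+-identityʳ _) (sym (toℚ-* (ℤ.- + k) (+ N)))) ⟩
    toℚ (+ (suc k * N)) ℚ.+ toℚ (ℤ.- + k ℤ.* + N)
      ≡⟨ toℚ-+ (+ (suc k * N)) (ℤ.- + k ℤ.* + N) ⟨
    toℚ (+ (suc k * N) ℤ.+ ℤ.- + k ℤ.* + N)
      ≡⟨ cong toℚ (trans (cong (ℤ._+ ℤ.- + k ℤ.* + N) (ℤ.pos-* (suc k) N)) (cancel (+ k) (+ N))) ⟩
    toℚ (+ N)
      ∎
    where
    open ≡-Reasoning
    K = toℚ (ℤ.- + k)
    cancel : ∀ k n → (1ℤ ℤ.+ k) ℤ.* n ℤ.+ ℤ.- k ℤ.* n ≡ n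
    cancel = ℤ.solve-∀
    negate : ∀ k v → ℤ.- (k ℤ.* v) ≡ ℤ.- k ℤ.* v
    negate = ℤ.solve-∀
    expand : ∀ j → toℚ (lookup (translate k y) j) ≡ toℚ (+ lookup y j) ℚ.+ K ℚ.* toℚ (diagonal N zero j)
    expand j = begin
      toℚ (lookup (translate k y) j)                                     ≡⟨ cong toℚ (lookup-translate k y j) ⟩
      toℚ (+ lookup y j ℤ.- + k ℤ.* diagonal N zero j)                   ≡⟨ cong (λ v → toℚ (+ lookup y j ℤ.+ v)) (negate (+ k) (diagonal N zero j)) ⟩
      toℚ (+ lookup y j ℤ.+ ℤ.- + k ℤ.* diagonal N zero j)               ≡⟨ toℚ-+ (+ lookup y j) (ℤ.- + k ℤ.* diagonal N zero j) ⟩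
      toℚ (+ lookup y j) ℚ.+ toℚ (ℤ.- + k ℤ.* diagonal N zero j)         ≡⟨ cong (toℚ (+ lookup y j) ℚ.+_) (toℚ-* (ℤ.- + k) (diagonal N zero j)) ⟩
      toℚ (+ lookup y j) ℚ.+ K ℚ.* toℚ (diagonal N zero j)               ∎

  dilateLatticePoint⇔ : ∀ {C : WordSet N (suc d)} (z : ZeroSum C) k x → DilateLatticePoint (simplex C z) (suc k) x ⇔
    (C (reduce x) × Σ[ y ∈ Vec ℕ (suc d) ] x ≡ translate k y × sum y ≡ suc k * N)
  dilateLatticePoint⇔ z k x = mk⇔
    (λ { ((x∈C , _) , x∈conv) → x∈C , ∈conv-dilate⁻ k x∈conv })
    (λ { (x∈C , y , refl , sum-y) →
         (x∈C , ∈aff⁺ (translate k y) (sumℚ-translate k y sum-y)) , ∈conv-dilate⁺ k y sum-y })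

-- Splitting lattice points into a codeword and a quotient

%ℕ-unique : ∀ {N} .{{_ : NonZero N}} {z} r t → r < N → z ≡ + r ℤ.+ t ℤ.* + N → z %ℕ N ≡ r
%ℕ-unique {N} {z} r t r<N z≡ = ℤ.+-injective (ℤ.i-j≡0⇒i≡j (+ r′) (+ r) (ℤ.∣i∣≡0⇒i≡0 (multiple-below-N (ℤ.∣ + r′ ℤ.- + r ∣) refl)))
  where
  r′ = z %ℕ N
  t′ = z /ℕ N
  open ≡-Reasoning
  solve-for : ∀ r′ r t t′ n → r′ ℤ.+ t′ ℤ.* n ≡ r ℤ.+ t ℤ.* n → r′ ℤ.- r ≡ (t ℤ.- t′) ℤ.* n
  solve-for r′ r t t′ n e = begin
    r′ ℤ.- r                                        ≡⟨ insert r′ r (t′ ℤ.* n) ⟩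
    r′ ℤ.+ t′ ℤ.* n ℤ.- (r ℤ.+ t′ ℤ.* n)            ≡⟨ cong (ℤ._- (r ℤ.+ t′ ℤ.* n)) e ⟩
    r ℤ.+ t ℤ.* n ℤ.- (r ℤ.+ t′ ℤ.* n)              ≡⟨ factor r t t′ n ⟩
    (t ℤ.- t′) ℤ.* n                                ∎
    where
    insert : ∀ a b c → a ℤ.- b ≡ a ℤ.+ c ℤ.- (b ℤ.+ c)
    insert = ℤ.solve-∀
    factor : ∀ r t t′ n → r ℤ.+ t ℤ.* n ℤ.- (r ℤ.+ t′ ℤ.* n) ≡ (t ℤ.- t′) ℤ.* n
    factor = ℤ.solve-∀
  difference : + r′ ℤ.- + r ≡ (t ℤ.- t′) ℤ.* + N
  difference = solve-for (+ r′) (+ r) t t′ (+ N) (trans (sym (a≡a%ℕn+[a/ℕn]*n z N)) z≡)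
  N∣ : N ∣ ℤ.∣ + r′ ℤ.- + r ∣
  N∣ = divides ℤ.∣ t ℤ.- t′ ∣ (trans (cong ℤ.∣_∣ difference) (ℤ.abs-* (t ℤ.- t′) (+ N)))
  -- Both remainders lie in [0, N), so their difference is too small to be a nonzero multiple of N.
  small : ℤ.∣ + r′ ℤ.- + r ∣ < N
  small = ≤-<-trans (subst (_≤ r′ ⊔ r) (cong ℤ.∣_∣ (sym (ℤ.m-n≡m⊖n r′ r))) (ℤ.∣m⊝n∣≤m⊔n r′ r)) (⊔-lub (n%ℕd<d z N) r<N)
  multiple-below-N : ∀ m → ℤ.∣ + r′ ℤ.- + r ∣ ≡ m → m ≡ 0
  multiple-below-N zero    _ = refl
  multiple-below-N (suc m) e = contradiction (subst (N ∣_) e N∣) (>⇒∤ (subst (_< N) e small))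

module _ {N : ℕ} .{{_ : NonZero N}} where

  weight : ∀ {n} → Word N n → ℕ
  weight c = sum (map toℕ c) / N

  lift : ∀ {n} → Word N n → Vec ℕ n → Vec ℕ n
  lift = zipWith λ c q → toℕ c + q * N

  sum-lift : ∀ {n} (c : Word N n) q → sum (lift c q) ≡ sum (map toℕ c) + sum q * N
  sum-lift []      []      = refl
  sum-lift (a ∷ c) (b ∷ q) = trans (cong (_+_ (toℕ a + b * N)) (sum-lift c q)) (interchange (toℕ a) b N (sum (map toℕ c)) (sum q))
    where
    interchange : ∀ a b n s t → (a + b * n) + (s + t * n) ≡ (a + s) + (b + t) * n
    interchange = solve-∀

  lift-injective : ∀ {n} (c : Word N n) {q q′} → lift c q ≡ lift c q′ → q ≡ q′
  lift-injective []      {[]}    {[]}     _ = refl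
  lift-injective (a ∷ c) {b ∷ q} {b′ ∷ q′} e with head≡ , tail≡ ← ∷-injective e =
    cong₂ _∷_ (*-cancelʳ-≡ b b′ N (+-cancelˡ-≡ (toℕ a) _ _ head≡)) (lift-injective c tail≡)

  lift-divMod : ∀ {n} (y : Vec ℕ n) → lift (map ⟦_⟧ y) (map (_/ N) y) ≡ y
  lift-divMod []      = refl
  lift-divMod (a ∷ y) = cong₂ _∷_ (trans (cong (_+ a / N * N) (toℕ-⟦⟧ a)) (sym (m≡m%n+[m/n]*n a N))) (lift-divMod y)

  module _ {d : ℕ} where

    -- Both `q` and the translation contribute multiples of N only. Hence the codeword can be read
    -- off from the lattice point.
    reduce-translate : ∀ k (c : Word N (suc d)) q → reduce (translate k (lift c q)) ≡ c
    reduce-translate k c q = lookup-extensional λ j → toℕ-injective (begin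
      toℕ (lookup (reduce (translate k (lift c q))) j)      ≡⟨ cong toℕ (lookup-map j _ (translate k (lift c q))) ⟩
      toℕ (fromℕ< (n%ℕd<d (lookup (translate k (lift c q)) j) N)) ≡⟨ toℕ-fromℕ< _ ⟩
      lookup (translate k (lift c q)) j %ℕ N                ≡⟨ %ℕ-unique (toℕ (lookup c j)) (shift j) (toℕ<n (lookup c j)) (entry j) ⟩
      toℕ (lookup c j)                                      ∎)
      where
      open ≡-Reasoning
      unit : Fin (suc d) → ℤ
      unit = diagonal 1 zero
      shift : Fin (suc d) → ℤ
      shift j = + lookup q j ℤ.- + k ℤ.* unit j
      diagonal-N : ∀ j → diagonal {suc d} N zero j ≡ unit j ℤ.* + N
      diagonal-N zero    = sym (ℤ.*-identityˡ (+ N))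
      diagonal-N (suc _) = refl
      regroup : ∀ a b n k u → a ℤ.+ b ℤ.* n ℤ.- k ℤ.* (u ℤ.* n) ≡ a ℤ.+ (b ℤ.- k ℤ.* u) ℤ.* n
      regroup = ℤ.solve-∀
      entry : ∀ j → lookup (translate k (lift c q)) j ≡ + toℕ (lookup c j) ℤ.+ shift j ℤ.* + N
      entry j = begin
        lookup (translate k (lift c q)) j
          ≡⟨ lookup-translate k (lift c q) j ⟩
        + lookup (lift c q) j ℤ.- + k ℤ.* diagonal N zero j
          ≡⟨ cong₂ (λ a b → + a ℤ.- + k ℤ.* b) (lookup-zipWith _ j c q) (diagonal-N j) ⟩
        + (toℕ (lookup c j) + lookup q j * N) ℤ.- + k ℤ.* (unit j ℤ.* + N)
          ≡⟨ cong (λ b → + toℕ (lookup c j) ℤ.+ b ℤ.- + k ℤ.* (unit j ℤ.* + N)) (ℤ.pos-* (lookup q j) N) ⟩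
        + toℕ (lookup c j) ℤ.+ + lookup q j ℤ.* + N ℤ.- + k ℤ.* (unit j ℤ.* + N)
          ≡⟨ regroup (+ toℕ (lookup c j)) (+ lookup q j) (+ N) (+ k) (unit j) ⟩
        + toℕ (lookup c j) ℤ.+ shift j ℤ.* + N
          ∎

    translate-injective : ∀ k {y y′ : Vec ℕ (suc d)} → translate {N} k y ≡ translate k y′ → y ≡ y′
    translate-injective k {y} {y′} e = lookup-extensional λ j → ℤ.+-injective
      (ℤ-cancelʳ (ℤ.- (+ k ℤ.* diagonal N zero j)) (+ lookup y j) (+ lookup y′ j)
        (trans (sym (lookup-translate k y j)) (trans (cong (λ x → lookup x j) e) (lookup-translate k y′ j))))

    latticePoints : ℕ → List (Word N (suc d)) → List (Point (suc d))
    latticePoints k []       = []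
    latticePoints k (c ∷ cs) =
      List.map (translate k ∘ lift c) (deficient (suc d) (weight c) (suc k)) List.++ latticePoints k cs

    ∈-latticePoints⁺ : ∀ k {cs c} q → c ∈ cs → weight c + sum q ≡ suc k → translate k (lift c q) ∈ latticePoints k cs
    ∈-latticePoints⁺ k {c = c} q (here refl) e = ∈-++⁺ˡ (∈-map⁺ (translate k ∘ lift c)
      (subst (λ j → q ∈ deficient (suc d) (weight c) j) e (∈-deficient⁺ (weight c) q)))
    ∈-latticePoints⁺ k q (there c∈) e = ∈-++⁺ʳ _ (∈-latticePoints⁺ k q c∈ e)

    ∈-latticePoints⁻ : ∀ k cs {x} → x ∈ latticePoints k cs →
      Σ[ c ∈ Word N (suc d) ] Σ[ q ∈ Vec ℕ (suc d) ] c ∈ cs × weight c + sum q ≡ suc k × x ≡ translate k (lift c q)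
    ∈-latticePoints⁻ k (c ∷ cs) x∈
      with ∈-++⁻ (List.map (translate k ∘ lift c) (deficient (suc d) (weight c) (suc k))) x∈
    ... | inj₁ x∈₁ = let q , q∈ , x≡ = ∈-map⁻ (translate k ∘ lift c) x∈₁
                     in c , q , here refl , ∈-deficient⁻ (suc d) (weight c) (suc k) q∈ , x≡
    ... | inj₂ x∈₂ = let c′ , q , c′∈ , e , x≡ = ∈-latticePoints⁻ k cs x∈₂ in c′ , q , there c′∈ , e , x≡

    -- Within the block of one codeword, `q` can be recovered from the point; different blocks are
    -- disjoint because reduction recovers the codeword.
    latticePoints-unique : ∀ k {cs} → Unique cs → Unique (latticePoints k cs)
    latticePoints-unique k []                          = []
    latticePoints-unique k {c ∷ cs} (c∉cs ∷ unique) = Unique.++⁺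
      (Unique.map⁺ (lift-injective c ∘ translate-injective k) (deficient-unique (suc d) (weight c) (suc k)))
      (latticePoints-unique k unique)
      disjoint
      where
      disjoint : ∀ {x} → x ∈ List.map (translate k ∘ lift c) (deficient (suc d) (weight c) (suc k)) × x ∈ latticePoints k cs → ⊥
      disjoint (x∈₁ , x∈₂) =
        let q , _ , x≡ = ∈-map⁻ (translate k ∘ lift c) x∈₁
            c′ , q′ , c′∈ , _ , x≡′ = ∈-latticePoints⁻ k cs x∈₂
            c≡c′ = trans (sym (reduce-translate k c q)) (trans (cong reduce (trans (sym x≡) x≡′)) (reduce-translate k c′ q′))
        in All.lookup c∉cs c′∈ c≡c′

    length-latticePoints : ∀ k cs → + length (latticePoints k cs) ≡ weightSeries (suc d) (List.map weight cs) (suc k)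
    length-latticePoints k []       = refl
    length-latticePoints k (c ∷ cs) = trans (cong +_ (trans (length-++ (List.map (translate k ∘ lift c) xs)) (cong (_+ length (latticePoints k cs)) (length-map (translate k ∘ lift c) xs))))
      (cong (λ n → + length xs ℤ.+ n) (length-latticePoints k cs))
      where xs = deficient (suc d) (weight c) (suc k)

    -- The formula h*(Δ_C, t) = Σ_{c ∈ C} t^(|c|/N).
    hStar-simplex : ∀ {C : WordSet N (suc d)} (z : ZeroSum C) {cs h} → Unique cs → (∀ c → c ∈ cs ⇔ C c) →
                    (∀ k → weightSeries 0 (List.map weight cs) k ≡ fromCoeffs h k) → fromCoeffs h 0 ≡ 1ℤ →
                    HasHStar (simplex C z) h
    hStar-simplex {C} z {cs} {h} unique cs⇔C weights h₀≡1 = record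
      { points   = λ k → length (latticePoints k cs)
      ; counts   = λ k → latticePoints k cs , latticePoints-unique k unique , member k , refl
      ; equation = λ k → begin
          ((1-t ^⊛ suc d) ⊛ ehrhartSeries (λ k → length (latticePoints k cs))) k
            ≡⟨ ⊛-congʳ {1-t ^⊛ suc d} ehrhart k ⟩
          ((1-t ^⊛ suc d) ⊛ weightSeries (suc d) ws) k
            ≡⟨ cong (λ m → ((1-t ^⊛ suc d) ⊛ weightSeries m ws) k) (+-identityʳ (suc d)) ⟨
          ((1-t ^⊛ suc d) ⊛ weightSeries (suc d + 0) ws) k
            ≡⟨ 1-t^⊛-weightSeries (suc d) 0 ws k ⟩
          weightSeries 0 ws k
            ≡⟨ weights k ⟩
          fromCoeffs h k
            ∎
      }
      where
      open ≡-Reasoning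
      ws = List.map weight cs
      ehrhart : ehrhartSeries (λ k → length (latticePoints k cs)) ≗ weightSeries (suc d) ws
      -- The constant term of the Ehrhart series is 1 by definition and not a count of points, so it
      -- is matched through the assumption on the constant coefficient of `h`.
      ehrhart zero    = sym (trans (weightSeries-zero (suc d) ws) (trans (weights 0) h₀≡1))
      ehrhart (suc k) = length-latticePoints k cs
      sum-word : ∀ {c} q → C c → sum (lift c q) ≡ (weight c + sum q) * N
      sum-word {c} q c∈C = begin
        sum (lift c q)                        ≡⟨ sum-lift c q ⟩
        sum (map toℕ c) + sum q * N           ≡⟨ cong (_+ sum q * N) (m/n*n≡m (z c c∈C)) ⟨
        weight c * N + sum q * N              ≡⟨ *-distribʳ-+ N (weight c) (sum q) ⟨
        (weight c + sum q) * N                ∎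
      member : ∀ k x → x ∈ latticePoints k cs ⇔ DilateLatticePoint (simplex C z) (suc k) x
      member k x = mk⇔
        (λ x∈ → let c , q , c∈ , e , x≡ = ∈-latticePoints⁻ k cs x∈
                    c∈C = Equivalence.to (cs⇔C c) c∈
                in Equivalence.from (dilateLatticePoint⇔ z k x)
                     ( subst C (sym (trans (cong reduce x≡) (reduce-translate k c q))) c∈C
                     , lift c q , x≡ , trans (sum-word q c∈C) (cong (_* N) e)))
        (λ x∈ → let x∈C , y , x≡ , sum-y = Equivalence.to (dilateLatticePoint⇔ z k x) x∈
                    -- Division of each y_j by N with remainder: the remainders form the codeword,
                    -- the quotients form `q`.
                    c = map ⟦_⟧ y
                    q = map (_/ N) y
                    x≡′ = trans x≡ (cong (translate k) (sym (lift-divMod y)))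
                    c∈C = subst C (trans (cong reduce x≡′) (reduce-translate k c q)) x∈C
                    total = trans (sym (sum-word q c∈C)) (trans (cong sum (lift-divMod y)) sum-y)
                in subst (_∈ latticePoints k cs) (sym x≡′)
                     (∈-latticePoints⁺ k q (Equivalence.from (cs⇔C c) c∈C) (*-cancelʳ-≡ (weight c + sum q) (suc k) N total)))

-- The codes of the lemma

module _ (N : ℕ) .{{_ : NonZero N}} (2∣N : 2 ∣ N) where

  private
    M : ℕ
    M = N / 2

    M*2≡N : M * 2 ≡ N
    M*2≡N = m/n*n≡m 2∣N

    half : ∀ {a b} → a ≈ b [mod 2 ] → M * a ≈ M * b [mod N ]
    half a≈b = ≈-modulus M*2≡N (*-scale-≈ M a≈b)

    mod-2 : ∀ {a b} → a ≈ b [mod N ] → a ≈ b [mod 2 ]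
    mod-2 a≈b = ≈-weaken M (≈-modulus (sym M*2≡N) a≈b)

    M≢0 : NonZero M
    M≢0 = m*n≢0⇒m≢0 M {{subst NonZero (sym M*2≡N) it}}

    M<N : M < N
    M<N = subst (M <_) M*2≡N (m<m*n M 2 {{M≢0}} (s≤s (s≤s z≤n)))

    0<N : 0 < N
    0<N = >-nonZero⁻¹ N

    toℕ-⟦⟧-unique : ∀ {a r} → a ≈ r [mod N ] → r < N → toℕ (⟦_⟧ {N} a) ≡ r
    toℕ-⟦⟧-unique {a} a≈r r<N = trans (toℕ-⟦⟧ a) (trans (≈⇒%≡ a≈r) (m<n⇒m%n≡m r<N))

    solvable-mod-N : ∀ {b₁ b₂} → gcd (gcd b₁ b₂) M ≡ 1 → b₁ ≈ 1 [mod 2 ] →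
                     ∀ a z → ∃₂ λ x y → x * b₁ + y * b₂ ≈ z [mod N ] × y ≈ a [mod 2 ]
    solvable-mod-N cop odd a z =
      let x , y , z≈ , a≈ = solvable {{M≢0}} cop odd a z in x , y , ≈-modulus M*2≡N z≈ , a≈

  -- The h*-polynomial of the code of `g`

  rows-g-zeroSum : ZeroSum ⟨ rows-g N ⟩
  rows-g-zeroSum c c∈ with a , z , refl ← Equivalence.to (rows-g⇔ N c) c∈ = ≈0⇒∣ (begin
    sum (map toℕ (word-g N a z))
      ≈⟨ +-cong-≈ (toℕ-⟦⟧-≈ (M * (a + z))) (+-cong-≈ (toℕ-⟦⟧-≈ (M * a)) (+-cong-≈ (toℕ-⟦⟧-≈ (M * z))
           (+-cong-≈ (toℕ-⟦⟧-≈ z) (+-cong-≈ (toℕ-⟦⟧-≈ (pred N * z)) ≈-refl)))) ⟩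
    -- The three multiples of M add up to 2M (a + z), a multiple of N, and the last two entries
    -- cancel modulo N.
    M * (a + z) + (M * a + (M * z + (z + (pred N * z + 0))))
      ≡⟨ collect M a z (pred N) ⟩
    pred N * z + z + (a + z) * (M * 2)
      ≡⟨ cong (λ n → pred N * z + z + (a + z) * n) M*2≡N ⟩
    pred N * z + z + (a + z) * N
      ≈⟨ +-multiple-≈ (pred N * z + z) (a + z) ⟩
    pred N * z + z
      ≈⟨ pred-*-inverse N z ⟩
    0
      ∎)
    where
    open ≈-Reasoning N
    collect : ∀ M a z p → M * (a + z) + (M * a + (M * z + (z + (p * z + 0)))) ≡ p * z + z + (a + z) * (M * 2)
    collect = solve-∀

  words-g : List (Word N 5)
  words-g = List.map (word-g N 0 ∘ toℕ) (allFin N) List.++ List.map (word-g N 1 ∘ toℕ) (allFin N)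

  word-g-injective : ∀ a b {i j : Fin N} → word-g N a (toℕ i) ≡ word-g N b (toℕ j) → i ≡ j
  word-g-injective a b {i} {j} e =
    trans (sym (⟦toℕ⟧ i)) (trans (∷-injectiveˡ (∷-injectiveʳ (∷-injectiveʳ (∷-injectiveʳ e)))) (⟦toℕ⟧ j))

  words-g-unique : Unique words-g
  words-g-unique = Unique.++⁺
    (Unique.map⁺ (word-g-injective 0 0) (Unique.allFin⁺ N))
    (Unique.map⁺ (word-g-injective 1 1) (Unique.allFin⁺ N))
    λ { (c∈₀ , c∈₁) → disjoint (proj₂ (proj₂ (∈-map⁻ _ c∈₀))) (proj₂ (proj₂ (∈-map⁻ _ c∈₁))) }
    where
    disjoint : ∀ {c i j} → c ≡ word-g N 0 i → c ≡ word-g N 1 j → ⊥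
    -- The second coordinate M a separates the two families: it is 0 for a = 0 and M for a = 1.
    disjoint e₀ e₁ = ≢-nonZero⁻¹ M {{M≢0}} (trans (sym (toℕ-⟦⟧-unique (≈-reflexive (*-identityʳ M)) M<N))
      (trans (cong toℕ (∷-injectiveˡ (∷-injectiveʳ (trans (sym e₁) e₀)))) (toℕ-⟦⟧-unique (≈-reflexive (*-zeroʳ M)) 0<N)))

  ∈-words-g⇔ : ∀ c → c ∈ words-g ⇔ ⟨ rows-g N ⟩ c
  ∈-words-g⇔ c = mk⇔ to from
    where
    to : c ∈ words-g → ⟨ rows-g N ⟩ c
    to c∈ with ∈-++⁻ (List.map (word-g N 0 ∘ toℕ) (allFin N)) c∈
    ... | inj₁ c∈₀ = let z , _ , e = ∈-map⁻ _ c∈₀ in Equivalence.from (rows-g⇔ N c) (0 , toℕ z , e)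
    ... | inj₂ c∈₁ = let z , _ , e = ∈-map⁻ _ c∈₁ in Equivalence.from (rows-g⇔ N c) (1 , toℕ z , e)
    -- As N is even, reducing z modulo N preserves the parity that enters the first and third
    -- coordinates.
    representative : ∀ {a b} z → a ≈ b [mod 2 ] → word-g N b (toℕ (⟦_⟧ {N} z)) ≡ word-g N a z
    representative z a≈b = word-cong N (half (+-cong-≈ (≈-sym a≈b) (mod-2 z≈))) (half (≈-sym a≈b)) (half (mod-2 z≈)) z≈
      where
      z≈ : toℕ (⟦_⟧ {N} z) ≈ z [mod N ]
      z≈ = toℕ-⟦⟧-≈ z
    from : ⟨ rows-g N ⟩ c → c ∈ words-g
    from c∈ with a , z , refl ← Equivalence.to (rows-g⇔ N c) c∈ with even⊎odd a
    ... | inj₁ even = ∈-++⁺ˡ (subst (_∈ List.map (word-g N 0 ∘ toℕ) (allFin N)) (representative z even)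
                        (∈-map⁺ (word-g N 0 ∘ toℕ) (∈-allFin ⟦ z ⟧)))
    ... | inj₂ odd  = ∈-++⁺ʳ _ (subst (_∈ List.map (word-g N 1 ∘ toℕ) (allFin N)) (representative z odd)
                        (∈-map⁺ (word-g N 1 ∘ toℕ) (∈-allFin ⟦ z ⟧)))

  -- Weights are sums in ℕ, so every entry needs its representative below N. The one of -z is the
  -- parameter `z⁻`, since it is N - z for nonzero z but 0 for z = 0.
  weight-word : ∀ {p q r z z⁻ p′ q′ r′ w} → p ≈ p′ [mod N ] → p′ < N → q ≈ q′ [mod N ] → q′ < N → r ≈ r′ [mod N ] → r′ < N →
                z < N → pred N * z ≈ z⁻ [mod N ] → z⁻ < N → p′ + q′ + r′ + (z + z⁻) ≡ w * N →
                weight (word N p q r z) ≡ w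
  weight-word {p} {q} {r} {z} {z⁻} {p′} {q′} {r′} {w} p≈ p< q≈ q< r≈ r< z< z⁻≈ z⁻< total =
    trans (cong (_/ N) (trans
      (cong₂ _+_ (toℕ-⟦⟧-unique p≈ p<) (cong₂ _+_ (toℕ-⟦⟧-unique q≈ q<) (cong₂ _+_ (toℕ-⟦⟧-unique r≈ r<)
        (cong₂ _+_ (toℕ-⟦⟧-unique {z} ≈-refl z<) (cong (_+ 0) (toℕ-⟦⟧-unique z⁻≈ z⁻<))))))
      (trans (reassociate p′ q′ r′ z z⁻) total))) (m*n/n≡m w N)
    where
    reassociate : ∀ p q r z y → p + (q + (r + (z + (y + 0)))) ≡ p + q + r + (z + y)
    reassociate = solve-∀

  private
    M*0≈0 : ∀ {a} → a ≈ 0 [mod 2 ] → M * a ≈ 0 [mod N ]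
    M*0≈0 a≈ = ≈-trans (half a≈) (≈-reflexive (*-zeroʳ M))

    M*1≈M : ∀ {a} → a ≈ 1 [mod 2 ] → M * a ≈ M [mod N ]
    M*1≈M a≈ = ≈-trans (half a≈) (≈-reflexive (*-identityʳ M))

    weight-nonzero : ∀ {p q r z p′ q′ r′ w} → p ≈ p′ [mod N ] → p′ < N → q ≈ q′ [mod N ] → q′ < N → r ≈ r′ [mod N ] → r′ < N →
                     suc z < N → p′ + q′ + r′ + N ≡ w * N → weight (word N p q r (suc z)) ≡ w
    weight-nonzero {z = z} {p′} {q′} {r′} p≈ p< q≈ q< r≈ r< z< total =
      weight-word p≈ p< q≈ q< r≈ r< z< (≈-sym (∸-≈-pred-* (<⇒≤ z<))) (∸-monoʳ-< (s≤s z≤n) (<⇒≤ z<))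
        (trans (cong (λ n → p′ + q′ + r′ + n) (m+[n∸m]≡n (<⇒≤ z<))) total)

    M+M+N≡2*N : M + M + N ≡ 2 * N
    M+M+N≡2*N = trans (cong (_+ N) (trans (double M) M*2≡N)) (cong (_+_ N) (sym (+-identityʳ N)))
      where
      double : ∀ m → m + m ≡ m * 2
      double = solve-∀

    twice-≈ : ∀ j → j * 2 ≈ 0 [mod 2 ]
    twice-≈ j = +-multiple-≈ 0 j

    suc-twice-≈ : ∀ j → suc (j * 2) ≈ 1 [mod 2 ]
    suc-twice-≈ j = +-multiple-≈ 1 j

  -- The weights for a = 0 and a = 1 as functions of z. Among the nonzero z the odd number 1 comes
  -- first, so the alternation starts with 2.
  weights₀ weights₁ : ℕ → ℕ
  weights₀ zero    = 0
  weights₀ (suc z) = alternate 2 1 z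
  weights₁ zero    = 1
  weights₁ (suc z) = 2

  weight-g₀ : ∀ z → z < N → weight (word-g N 0 z) ≡ weights₀ z
  weight-g₀ zero z< = weight-word (M*0≈0 ≈-refl) 0<N (M*0≈0 ≈-refl) 0<N (M*0≈0 ≈-refl) 0<N z< (≈-reflexive (*-zeroʳ (pred N))) 0<N refl
  weight-g₀ (suc z) z< with twice⊎suc-twice z
  -- The matched `z` is one less than the fourth coordinate, which is therefore odd here: the first
  -- and third coordinates are both M.
  ... | inj₁ (j , refl) = trans
    (weight-nonzero (M*1≈M (suc-twice-≈ j)) M<N (M*0≈0 ≈-refl) 0<N (M*1≈M (suc-twice-≈ j)) M<N z<
      (trans (cong (λ n → n + M + N) (+-identityʳ M)) M+M+N≡2*N))
    (sym (alternate-even 2 1 j))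
  ... | inj₂ (j , refl) = trans
    (weight-nonzero (M*0≈0 (twice-≈ (suc j))) 0<N (M*0≈0 ≈-refl) 0<N (M*0≈0 (twice-≈ (suc j))) 0<N z< (sym (+-identityʳ N)))
    (sym (alternate-odd 2 1 j))

  -- Exactly one of 1 + z and z is odd, so besides M a = M there is always one further entry M, and
  -- the two contribute weight 1. The last two entries add another 1 unless z = 0.
  weight-g₁ : ∀ z → z < N → weight (word-g N 1 z) ≡ weights₁ z
  weight-g₁ zero z< = weight-word (M*1≈M ≈-refl) M<N (M*1≈M ≈-refl) M<N (M*0≈0 ≈-refl) 0<N z< (≈-reflexive (*-zeroʳ (pred N))) 0<N
    (trans (collect M) (trans M*2≡N (sym (+-identityʳ N))))
    where
    collect : ∀ m → m + m + 0 + 0 ≡ m * 2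
    collect = solve-∀
  weight-g₁ (suc z) z< with twice⊎suc-twice z
  ... | inj₁ (j , refl) =
    weight-nonzero (M*0≈0 (twice-≈ (suc j))) 0<N (M*1≈M ≈-refl) M<N (M*1≈M (suc-twice-≈ j)) M<N z< M+M+N≡2*N
  ... | inj₂ (j , refl) =
    weight-nonzero (M*1≈M (suc-twice-≈ (suc j))) M<N (M*1≈M ≈-refl) M<N (M*0≈0 (twice-≈ (suc j))) 0<N z<
      (trans (cong (_+ N) (+-identityʳ (M + M))) M+M+N≡2*N)

  weights-words-g : List.map weight words-g ≡ applyUpTo weights₀ N List.++ applyUpTo weights₁ N
  weights-words-g = trans (map-++ weight (List.map (word-g N 0 ∘ toℕ) (allFin N)) _)
    (cong₂ List._++_ (family 0 weight-g₀) (family 1 weight-g₁))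
    where
    family : ∀ a {w} → (∀ z → z < N → weight (word-g N a z) ≡ w z) →
             List.map weight (List.map (word-g N a ∘ toℕ) (allFin N)) ≡ applyUpTo w N
    family a weight≡ = trans (sym (map-∘ (allFin N)))
      (trans (map-tabulate id (weight ∘ word-g N a ∘ toℕ)) (tabulate-applyUpTo N λ i → weight≡ (toℕ i) (toℕ<n i)))

  -- Weight 2 occurs for the M odd z with a = 0 and the N - 1 nonzero z with a = 1, in all 3M - 1
  -- times. Weight 1 occurs for the M - 1 nonzero even z with a = 0 and once at a = 1, z = 0.
  weightSeries-g : ∀ k → weightSeries 0 (applyUpTo weights₀ N List.++ applyUpTo weights₁ N) k ≡
                         shiftedSeries 0 0 k ℤ.+ + M ℤ.* shiftedSeries 0 1 k ℤ.+ (+ (3 * M) ℤ.- 1ℤ) ℤ.* shiftedSeries 0 2 k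
  weightSeries-g k = begin
    weightSeries 0 (applyUpTo weights₀ N List.++ applyUpTo weights₁ N) k
      ≡⟨ weightSeries-++ 0 (applyUpTo weights₀ N) _ k ⟩
    weightSeries 0 (applyUpTo weights₀ N) k ℤ.+ weightSeries 0 (applyUpTo weights₁ N) k
      -- Writing N as `suc m * 2` exposes the exceptional entry z = 0 at the head of both lists.
      ≡⟨ cong (λ n → weightSeries 0 (applyUpTo weights₀ n) k ℤ.+ weightSeries 0 (applyUpTo weights₁ n) k)
           (trans (sym M*2≡N) (cong (_* 2) M≡)) ⟩
    (S 0 ℤ.+ weightSeries 0 (applyUpTo (alternate 2 1) (suc (m * 2))) k) ℤ.+
    (S 1 ℤ.+ weightSeries 0 (applyUpTo (λ _ → 2) (suc (m * 2))) k)
      ≡⟨ cong₂ (λ a b → (S 0 ℤ.+ a) ℤ.+ (S 1 ℤ.+ b)) (weightSeries-alternate 0 2 1 m k)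
           (trans (weightSeries-const 0 2 (suc (m * 2)) k) (cong (λ n → (1ℤ ℤ.+ n) ℤ.* S 2) (ℤ.pos-* m 2))) ⟩
    (S 0 ℤ.+ ((1ℤ ℤ.+ + m) ℤ.* S 2 ℤ.+ + m ℤ.* S 1)) ℤ.+ (S 1 ℤ.+ (1ℤ ℤ.+ + m ℤ.* + 2) ℤ.* S 2)
      ≡⟨ collect (+ m) (S 0) (S 1) (S 2) ⟩
    S 0 ℤ.+ + suc m ℤ.* S 1 ℤ.+ (+ 3 ℤ.* + suc m ℤ.- 1ℤ) ℤ.* S 2
      ≡⟨ cong (λ n → S 0 ℤ.+ + n ℤ.* S 1 ℤ.+ (+ 3 ℤ.* + n ℤ.- 1ℤ) ℤ.* S 2) M≡ ⟨
    S 0 ℤ.+ + M ℤ.* S 1 ℤ.+ (+ 3 ℤ.* + M ℤ.- 1ℤ) ℤ.* S 2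
      ≡⟨ cong (λ n → S 0 ℤ.+ + M ℤ.* S 1 ℤ.+ (n ℤ.- 1ℤ) ℤ.* S 2) (ℤ.pos-* 3 M) ⟨
    S 0 ℤ.+ + M ℤ.* S 1 ℤ.+ (+ (3 * M) ℤ.- 1ℤ) ℤ.* S 2
      ∎
    where
    open ≡-Reasoning
    S : ℕ → ℤ
    S w = shiftedSeries 0 w k
    m = pred M
    M≡ : M ≡ suc m
    M≡ = sym (suc-pred M {{M≢0}})
    collect : ∀ m a b c → (a ℤ.+ ((1ℤ ℤ.+ m) ℤ.* c ℤ.+ m ℤ.* b)) ℤ.+ (b ℤ.+ (1ℤ ℤ.+ m ℤ.* + 2) ℤ.* c) ≡
                          a ℤ.+ (1ℤ ℤ.+ m) ℤ.* b ℤ.+ (+ 3 ℤ.* (1ℤ ℤ.+ m) ℤ.- 1ℤ) ℤ.* c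
    collect = ℤ.solve-∀

  hStar-g : HasHStar (simplex ⟨ rows-g N ⟩ rows-g-zeroSum) (+ 1 ∷ + (N / 2) ∷ (+ (3 * N / 2) ℤ.- + 1) ∷ [])
  hStar-g = hStar-simplex rows-g-zeroSum words-g-unique ∈-words-g⇔ weights≡ refl
    where
    -- With exponent 0 in the denominator, `shiftedSeries 0 w` is the monomial t^w.
    polynomial : ∀ a b k → shiftedSeries 0 0 k ℤ.+ a ℤ.* shiftedSeries 0 1 k ℤ.+ b ℤ.* shiftedSeries 0 2 k ≡
                           fromCoeffs (1ℤ ∷ a ∷ b ∷ []) k
    polynomial a b 0 = evaluate a b
      where
      evaluate : ∀ a b → 1ℤ ℤ.+ a ℤ.* 0ℤ ℤ.+ b ℤ.* 0ℤ ≡ 1ℤ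
      evaluate = ℤ.solve-∀
    polynomial a b 1 = evaluate a b
      where
      evaluate : ∀ a b → 0ℤ ℤ.+ a ℤ.* 1ℤ ℤ.+ b ℤ.* 0ℤ ≡ a
      evaluate = ℤ.solve-∀
    polynomial a b 2 = evaluate a b
      where
      evaluate : ∀ a b → 0ℤ ℤ.+ a ℤ.* 0ℤ ℤ.+ b ℤ.* 1ℤ ≡ b
      evaluate = ℤ.solve-∀
    polynomial a b (suc (suc (suc k))) = evaluate a b
      where
      evaluate : ∀ a b → 0ℤ ℤ.+ a ℤ.* 0ℤ ℤ.+ b ℤ.* 0ℤ ≡ 0ℤ
      evaluate = ℤ.solve-∀
    weights≡ : ∀ k → weightSeries 0 (List.map weight words-g) k ≡ fromCoeffs (+ 1 ∷ + M ∷ (+ (3 * N / 2) ℤ.- + 1) ∷ []) k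
    weights≡ k = trans (cong (λ ws → weightSeries 0 ws k) weights-words-g) (trans (weightSeries-g k)
      (trans (polynomial (+ M) _ k)
        (cong (λ n → fromCoeffs (+ 1 ∷ + M ∷ (+ n ℤ.- + 1) ∷ []) k) (sym (*-/-assoc 3 2∣N)))))

  -- The dichotomy for the code of b₁ and b₂

  module _ (b₁ b₂ : ℤ/ N) (coprime : gcd (gcd (toℕ b₁) (toℕ b₂)) (N / 2) ≡ 1) where

    private
      β₁ β₂ : ℕ
      β₁ = toℕ b₁
      β₂ = toℕ b₂

      +-parity : ∀ {p q} x y → β₁ ≈ p [mod 2 ] → β₂ ≈ q [mod 2 ] → x * β₁ + y * β₂ ≈ x * p + y * q [mod 2 ]
      +-parity x y β₁≈ β₂≈ = +-cong-≈ (*-congˡ-≈ x β₁≈) (*-congˡ-≈ y β₂≈)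

      -- An involution recovers `c` by being applied once more, so equations of one shape serve both
      -- inclusions.
      isomorphism : ∀ (σ : Perm.Permutation′ 5) → (∀ (c : Word N 5) → permute σ (permute σ c) ≡ c) →
                    (∀ x y → ∃₂ λ a z → permute σ (word-b N β₁ β₂ x y) ≡ word-g N a z) →
                    (∀ a z → ∃₂ λ x y → permute σ (word-b N β₁ β₂ x y) ≡ word-g N a z) →
                    ⟨ rows-b N b₁ b₂ ⟩ ≅ ⟨ rows-g N ⟩
      isomorphism σ involutive into onto = σ , λ c → mk⇔
        (λ c∈ → let x , y , e = Equivalence.to (rows-b⇔ N b₁ b₂ c) c∈
                    a , z , f = into x y
                in Equivalence.from (rows-g⇔ N _) (a , z , trans (cong (permute σ) e) f))
        (λ c∈ → let a , z , e = Equivalence.to (rows-g⇔ N _) c∈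
                    x , y , f = onto a z
                in Equivalence.from (rows-b⇔ N b₁ b₂ c) (x , y ,
                     trans (sym (involutive c)) (trans (cong (permute σ) (trans e (sym f))) (involutive _))))

    -- Here z ≡ x modulo 2, so M x = M z is already in third place and y serves as a.
    ≅-odd-even : β₁ ≈ 1 [mod 2 ] → β₂ ≈ 0 [mod 2 ] → ⟨ rows-b N b₁ b₂ ⟩ ≅ ⟨ rows-g N ⟩
    ≅-odd-even odd even = isomorphism Perm.id (λ { (_ ∷ _ ∷ _ ∷ _ ∷ _ ∷ []) → refl })
      (λ x y → y , _ , word≡ x y y _ ≈-refl ≈-refl)
      (λ a z → let x , y , z≈ , a≈ = solvable-mod-N coprime odd a z in x , y , word≡ x y a z z≈ a≈)
      where
      word≡ : ∀ x y a z → x * β₁ + y * β₂ ≈ z [mod N ] → y ≈ a [mod 2 ] → word-b N β₁ β₂ x y ≡ word-g N a z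
      word≡ x y a z z≈ a≈ = word-cong N
        (half (≈-trans (+-cong-≈ x≈z a≈) (≈-reflexive (+-comm z a)))) (half a≈) (half x≈z) z≈
        where
        x≈z : x ≈ z [mod 2 ]
        x≈z = ≈-trans (≈-reflexive (drop x y)) (≈-trans (≈-sym (+-parity x y odd even)) (mod-2 z≈))
          where
          drop : ∀ x y → x ≡ x * 1 + y * 0
          drop = solve-∀

    -- Here z ≡ y modulo 2, so M y moves to third place and x serves as a. Solvability needs the odd
    -- coefficient first, hence the symmetry of the gcd.
    ≅-even-odd : β₁ ≈ 0 [mod 2 ] → β₂ ≈ 1 [mod 2 ] → ⟨ rows-b N b₁ b₂ ⟩ ≅ ⟨ rows-g N ⟩
    ≅-even-odd even odd = isomorphism (Perm.transpose 1F 2F) (λ { (_ ∷ _ ∷ _ ∷ _ ∷ _ ∷ []) → refl })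
      (λ x y → x , _ , word≡ x y x _ ≈-refl ≈-refl)
      (λ a z → let y , x , z≈ , a≈ = solvable-mod-N (trans (cong (λ g → gcd g M) (gcd-comm β₂ β₁)) coprime) odd a z
               in x , y , word≡ x y a z (≈-trans (≈-reflexive (+-comm (x * β₁) _)) z≈) a≈)
      where
      word≡ : ∀ x y a z → x * β₁ + y * β₂ ≈ z [mod N ] → x ≈ a [mod 2 ] →
              permute (Perm.transpose 1F 2F) (word-b N β₁ β₂ x y) ≡ word-g N a z
      word≡ x y a z z≈ a≈ = word-cong N (half (+-cong-≈ a≈ y≈z)) (half a≈) (half y≈z) z≈
        where
        y≈z : y ≈ z [mod 2 ]
        y≈z = ≈-trans (≈-reflexive (drop x y)) (≈-trans (≈-sym (+-parity x y even odd)) (mod-2 z≈))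
          where
          drop : ∀ x y → y ≡ x * 0 + y * 1
          drop = solve-∀

    -- Here z ≡ x + y modulo 2, so M (x + y) moves to third place and y serves as a. The first entry
    -- is then M x, and x ≡ y + (x + y) ≡ a + z modulo 2.
    ≅-odd-odd : β₁ ≈ 1 [mod 2 ] → β₂ ≈ 1 [mod 2 ] → ⟨ rows-b N b₁ b₂ ⟩ ≅ ⟨ rows-g N ⟩
    ≅-odd-odd odd₁ odd₂ = isomorphism (Perm.transpose 0F 2F) (λ { (_ ∷ _ ∷ _ ∷ _ ∷ _ ∷ []) → refl })
      (λ x y → y , _ , word≡ x y y _ ≈-refl ≈-refl)
      (λ a z → let x , y , z≈ , a≈ = solvable-mod-N coprime odd₁ a z in x , y , word≡ x y a z z≈ a≈)
      where
      word≡ : ∀ x y a z → x * β₁ + y * β₂ ≈ z [mod N ] → y ≈ a [mod 2 ] →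
              permute (Perm.transpose 0F 2F) (word-b N β₁ β₂ x y) ≡ word-g N a z
      word≡ x y a z z≈ a≈ = word-cong N
        (half (≈-trans (≈-sym (+-multiple-≈ x y)) (≈-trans (≈-reflexive (regroup x y)) (+-cong-≈ a≈ x+y≈z))))
        (half a≈) (half x+y≈z) z≈
        where
        regroup : ∀ x y → x + y * 2 ≡ y + (x + y)
        regroup = solve-∀
        x+y≈z : x + y ≈ z [mod 2 ]
        x+y≈z = ≈-trans (≈-reflexive (expand x y)) (≈-trans (≈-sym (+-parity x y odd₁ odd₂)) (mod-2 z≈))
          where
          expand : ∀ x y → x + y ≡ x * 1 + y * 1
          expand = solve-∀

    -- Otherwise 2 would divide the gcd of β₁, β₂ and M, which is 1.
    half-odd : β₁ ≈ 0 [mod 2 ] → β₂ ≈ 0 [mod 2 ] → M ≈ 1 [mod 2 ]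
    half-odd even₁ even₂ with even⊎odd M
    ... | inj₂ M-odd  = M-odd
    ... | inj₁ M-even = contradiction
      (subst (2 ∣_) coprime (gcd-greatest (gcd-greatest (≈0⇒∣ even₁) (≈0⇒∣ even₂)) (≈0⇒∣ M-even)))
      (>⇒∤ (s≤s (s≤s z≤n)))

    -- For odd M the substitution x ↦ M p + (M + 1) x is ≡ p mod 2 and acts as x on even entries mod 2M,
    -- so the two blocks of coordinates vary independently.
    directSum-even : β₁ ≈ 0 [mod 2 ] → β₂ ≈ 0 [mod 2 ] → IsDirectSum ⟨ rows-b N b₁ b₂ ⟩
    directSum-even even₁ even₂ = isDirectSum (Span-linear r₁ s₁) (Span-linear r₂ s₂) λ c → mk⇔
      (λ c∈ → let x , y , e = Equivalence.to (rows-b⇔Span N b₁ b₂ c) c∈ in _ , _ , (x , y , refl) , (x , y , refl) , e)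
      (λ { (_ , _ , (p , q , refl) , (x , y , refl) , e) →
           Equivalence.from (rows-b⇔Span N b₁ b₂ c) (mix p x , mix q y , trans e (sym (mixed p q x y))) })
      where
      r₁ s₁ : Vec ℕ 3
      r₁ = M ∷ 0 ∷ M ∷ []
      s₁ = M ∷ M ∷ 0 ∷ []

      r₂ s₂ : Vec ℕ 2
      r₂ = β₁ ∷ pred N * β₁ ∷ []
      s₂ = β₂ ∷ pred N * β₂ ∷ []

      M-odd : M ≈ 1 [mod 2 ]
      M-odd = half-odd even₁ even₂

      -- The Chinese remainder theorem for ℤ/2M ≅ ℤ/2 × ℤ/M: for odd M, the numbers M and M + 1
      -- represent the two complementary idempotents.
      mix : ℕ → ℕ → ℕ
      mix p x = M * p + (M + 1) * x

      mix-M : ∀ p x → mix p x * M ≈ p * M [mod N ]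
      mix-M p x = ≈-trans (≈-reflexive (*-comm _ M)) (≈-trans (half mix≈p) (≈-reflexive (*-comm M p)))
        where
        expand : ∀ p x → 1 * p + (1 + 1) * x ≡ p + x * 2
        expand = solve-∀
        mix≈p : mix p x ≈ p [mod 2 ]
        mix≈p = ≈-trans (+-cong-≈ (*-cong-≈ M-odd ≈-refl) (*-cong-≈ (+-cong-≈ M-odd ≈-refl) ≈-refl))
                  (≈-trans (≈-reflexive (expand p x)) (+-multiple-≈ p x))

      mix-even : ∀ p x {b} → b ≈ 0 [mod 2 ] → mix p x * b ≈ x * b [mod N ]
      mix-even p x {b} b≈0 = ≈-trans (≈-reflexive (regroup M p x b))
        (+-cong-≈ (≈-trans (half (*-congˡ-≈ (p + x) b≈0)) (≈-reflexive (vanish M (p + x)))) ≈-refl)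
        where
        regroup : ∀ M p x b → (M * p + (M + 1) * x) * b ≡ M * ((p + x) * b) + x * b
        regroup = solve-∀
        vanish : ∀ M c → M * (c * 0) ≡ 0
        vanish = solve-∀

      mixed : ∀ p q x y → map ⟦_⟧ (linearCombination (mix p x) (mix q y) (r₁ ++ r₂) (s₁ ++ s₂)) ≡
                          map (⟦_⟧ {N}) (linearCombination p q r₁ s₁) ++ map ⟦_⟧ (linearCombination x y r₂ s₂)
      mixed p q x y =
        cong₂ _∷_ (≈⇒⟦⟧≡ (+-cong-≈ (mix-M p x) (mix-M q y))) (
        cong₂ _∷_ (≈⇒⟦⟧≡ (+-cong-≈ (mix-0 p x) (mix-M q y))) (
        cong₂ _∷_ (≈⇒⟦⟧≡ (+-cong-≈ (mix-M p x) (mix-0 q y))) (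
        cong₂ _∷_ (≈⇒⟦⟧≡ (+-cong-≈ (mix-even p x even₁) (mix-even q y even₂))) (
        cong₂ _∷_ (≈⇒⟦⟧≡ (+-cong-≈ (mix-even p x (neg-even even₁)) (mix-even q y (neg-even even₂)))) refl))))
        where
        mix-0 : ∀ p x → mix p x * 0 ≈ p * 0 [mod N ]
        mix-0 p x = ≈-reflexive (trans (*-zeroʳ (mix p x)) (sym (*-zeroʳ p)))
        neg-even : ∀ {b} → b ≈ 0 [mod 2 ] → pred N * b ≈ 0 [mod 2 ]
        neg-even b≈0 = ≈-trans (*-congˡ-≈ (pred N) b≈0) (≈-reflexive (*-zeroʳ (pred N)))

    directSum⊎≅ : IsDirectSum ⟨ rows-b N b₁ b₂ ⟩ ⊎ ⟨ rows-b N b₁ b₂ ⟩ ≅ ⟨ rows-g N ⟩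
    directSum⊎≅ with even⊎odd β₁ | even⊎odd β₂
    ... | inj₁ even₁ | inj₁ even₂ = inj₁ (directSum-even even₁ even₂)
    ... | inj₁ even₁ | inj₂ odd₂  = inj₂ (≅-even-odd even₁ odd₂)
    ... | inj₂ odd₁  | inj₁ even₂ = inj₂ (≅-odd-even odd₁ even₂)
    ... | inj₂ odd₁  | inj₂ odd₂  = inj₂ (≅-odd-odd odd₁ odd₂)

lemma3p9 : (N : ℕ) .{{_ : NonZero N}} → 2 ≤ N → 2 ∣ N →
    ((b₁ b₂ : ℤ/ N) →
    ¬ (b₁ ≡ ⟦ 0 ⟧ × b₂ ≡ ⟦ 0 ⟧) →
    gcd (gcd (toℕ b₁) (toℕ b₂)) (N / 2) ≡ 1 →
    IsDirectSum ⟨ rows-b N b₁ b₂ ⟩ ⊎ ⟨ rows-b N b₁ b₂ ⟩ ≅ ⟨ rows-g N ⟩)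
    ×
    (Σ[ z ∈ ZeroSum ⟨ rows-g N ⟩ ]
    HasHStar (simplex ⟨ rows-g N ⟩ z)
    (+ 1 ∷ + (N / 2) ∷ (+ (3 * N / 2) - + 1) ∷ []))
lemma3p9 N _ 2∣N =
  (λ b₁ b₂ _ coprime → directSum⊎≅ N 2∣N b₁ b₂ coprime) , rows-g-zeroSum N 2∣N , hStar-g N 2∣N
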